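{- Let ${\mathcal{A}}$ be an exact algorithm for MaxCover with running time $f(K,n,m)$. For every MaxCover instance $(N,{\mathcal{S}},K)$ (with $m\ge K$) and every integer $X$ with $0\le X\le K$, Algorithm A4 returns at most $K$ sets covering at least $\left(1-\frac{X}{K}e^{ -X/K}\right)\cdot\mathrm{OPT}$ elements, where $\mathrm{OPT}$ is the maximum number of elements coverable by $K$ sets of ${\mathcal{S}}$, and it runs in time $f(K-X,n,m)+\mathrm{poly}(n,K,m)$.
   Context: A MaxCover instance $(N,{\mathcal{S}},K)$: a set $N$ of $n$ elements, a family ${\mathcal{S}}$ of $m$ subsets of $N$, integer $K$; goal: at most $K$ sets maximizing the number of covered elements (no frequency restriction). Algorithm A4: starting from $C=\emptyset$, perform $X$ greedy steps, each adding a set $S\in{\mathcal{S}}\setminus C$ maximizing $|S\setminus\bigcup_{T\in C}T|$; let $U=N\setminus\bigcup_{T\in C}T$; run ${\mathcal{A}}$ on the instance with element set $U$, sets $\{S\cap U: S\in{\mathcal{S}}\setminus C\}$ and budget $K-X$, obtaining $C'$; return $C\cup C'$. -}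

module Defs where

open import Data.Bool.Base using (Bool; true; false; not; _∧_; _∨_; if_then_else_)
open import Data.Fin.Base using (Fin; zero; suc)
open import Data.Fin.Subset using (Subset; Side; inside; outside; ⋃; ∣_∣)
open import Data.Integer.Base using (+_)
open import Data.Maybe.Base using (Maybe; just; nothing)
open import Data.Nat.Base as ℕ using (ℕ; zero; suc; NonZero; _<ᵇ_; _∸_)
open import Data.Nat.Solver using (module +-*-Solver)
open import Data.Product.Base using (Σ; ∃; _×_; _,_)
open import Data.Rational.Base as ℚ using (ℚ; 0ℚ; 1ℚ; _/_)
open import Data.Unit.Base using (⊤; tt)
open import Data.Vec.Base using (Vec; []; _∷_; toList; _[_]≔_)
open import Relation.Binary.PropositionalEquality.Core using (_≡_)

private
  variable
    A B C : Set
    k m n : ℕ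

-- The element set is Fin n, and the family S₀ , … , Sₘ₋₁ is a vector of
-- subsets of it.  The budget is kept separate from the family.

Family : ℕ → ℕ → Set
Family n m = Vec (Subset n) m

-- The entries of a vector at the positions belonging to p, in order.

select : (p : Subset k) → Vec A k → Vec A ∣ p ∣
select []            []       = []
select (inside  ∷ p) (x ∷ xs) = x ∷ select p xs
select (outside ∷ p) (x ∷ xs) = select p xs

-- The union of the sets Sᵢ with i ∈ C.

covered : Family n m → Subset m → Subset n
covered 𝒮 C = ⋃ (toList (select C 𝒮))

-- opt is the maximum number of elements coverable by K sets; since the
-- sets are indexed, it exists exactly when K ≤ m.

IsOPT : Family n m → ℕ → ℕ → Set
IsOPT {m = m} 𝒮 K opt =
  (Σ (Subset m) λ D → ∣ D ∣ ≡ K × ∣ covered 𝒮 D ∣ ≡ opt) ×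
  (∀ D → ∣ D ∣ ≡ K → ∣ covered 𝒮 D ∣ ℕ.≤ opt)

-- Cost model (unit-cost RAM): every clause of every timed function pays
-- one tick, which accounts for the boundedly many operations that the
-- clause itself performs on bits, vector cells, and numbers or indices
-- of size at most max(n, m, K).  All other time comes from the timed
-- functions that the clause calls.

record Timed (A : Set) : Set where
  constructor _after_
  field
    value : A
    time  : ℕ

open Timed public

infixl 1 _>>=_ _>>_

return : A → Timed A
return x = x after 0

_>>=_ : Timed A → (A → Timed B) → Timed B
(x after s) >>= f = value (f x) after (s ℕ.+ time (f x))

_>>_ : Timed A → Timed B → Timed B
t >> u = t >>= λ _ → u

tick : Timed ⊤
tick = tt after 1

-- An algorithm for MaxCover takes a family and a budget, and returns the
-- set of indices of the members of the family that it selects.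

Algorithm : Set
Algorithm = ∀ {n m} → Family n m → ℕ → Timed (Subset m)

IsExact : Algorithm → Set
IsExact 𝒜 = ∀ {n m} (𝒮 : Family n m) (K : ℕ) →
  let C = value (𝒜 𝒮 K) in
  ∣ C ∣ ℕ.≤ K ×
  (∀ D → ∣ D ∣ ℕ.≤ K → ∣ covered 𝒮 D ∣ ℕ.≤ ∣ covered 𝒮 C ∣)

-- f K n m bounds the time spent on every instance with at most n
-- elements, at most m sets and budget K.

HasRunningTime : Algorithm → (ℕ → ℕ → ℕ → ℕ) → Set
HasRunningTime 𝒜 f = ∀ {n m n′ m′} (𝒮 : Family n′ m′) (K : ℕ) →
  n′ ℕ.≤ n → m′ ℕ.≤ m → time (𝒜 𝒮 K) ℕ.≤ f K n m

-- Polynomials with coefficients in ℕ.  The library's syntax includes a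
-- negation, which over the semiring ℕ is interpreted as the identity.

open +-*-Solver public using (Polynomial; ⟦_⟧)

replicateᵗ : (n : ℕ) → A → Timed (Vec A n)
replicateᵗ zero    x = do tick; return []
replicateᵗ (suc n) x = do
  tick
  xs ← replicateᵗ n x
  return (x ∷ xs)

zipWithᵗ : (A → B → Timed C) → Vec A n → Vec B n → Timed (Vec C n)
zipWithᵗ f []       []       = do tick; return []
zipWithᵗ f (x ∷ xs) (y ∷ ys) = do
  tick
  z  ← f x y
  zs ← zipWithᵗ f xs ys
  return (z ∷ zs)

mapᵗ : (A → Timed B) → Vec A n → Timed (Vec B n)
mapᵗ f []       = do tick; return []
mapᵗ f (x ∷ xs) = do
  tick
  y  ← f x
  ys ← mapᵗ f xs
  return (y ∷ ys)

selectᵗ : (p : Subset k) → Vec A k → Timed (Vec A ∣ p ∣)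
selectᵗ []            []       = do tick; return []
selectᵗ (inside  ∷ p) (x ∷ xs) = do
  tick
  ys ← selectᵗ p xs
  return (x ∷ ys)
selectᵗ (outside ∷ p) (x ∷ xs) = do tick; selectᵗ p xs

-- Reads a subset of the positions belonging to p, numbered as by select,
-- as a subset of all positions.

embedᵗ : (p : Subset k) → Subset ∣ p ∣ → Timed (Subset k)
embedᵗ []            []      = do tick; return []
embedᵗ (inside  ∷ p) (x ∷ q) = do
  tick
  r ← embedᵗ p q
  return (x ∷ r)
embedᵗ (outside ∷ p) q       = do
  tick
  r ← embedᵗ p q
  return (outside ∷ r)

∅ᵗ : Timed (Subset n)
∅ᵗ = replicateᵗ _ outside

∁ᵗ : Subset n → Timed (Subset n)
∁ᵗ = mapᵗ λ x → do tick; return (not x)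

_∪ᵗ_ : Subset n → Subset n → Timed (Subset n)
_∪ᵗ_ = zipWithᵗ λ x y → do tick; return (x ∨ y)

_∖ᵗ_ : Subset n → Subset n → Timed (Subset n)
_∖ᵗ_ = zipWithᵗ λ x y → do tick; return (x ∧ not y)

sizeᵗ : Subset n → Timed ℕ
sizeᵗ []      = do tick; return 0
sizeᵗ (x ∷ p) = do
  tick
  s ← sizeᵗ p
  return (if x then suc s else s)

coveredᵗ : Family n m → Subset m → Timed (Subset n)
coveredᵗ []      []            = do tick; ∅ᵗ
coveredᵗ (S ∷ 𝒮) (inside  ∷ C) = do
  tick
  V ← coveredᵗ 𝒮 C
  S ∪ᵗ V
coveredᵗ (S ∷ 𝒮) (outside ∷ C) = do tick; coveredᵗ 𝒮 C

-- A greedy step of A4 may choose any set of maximum gain.  A tie-breaking rule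
-- resolves this: if Sᵢ and Sⱼ, i < j, have equal gain when C has been
-- chosen, then Sᵢ is preferred to Sⱼ precisely if the rule returns true
-- for C, i and j.  Every sequence of choices of maximum-gain sets arises
-- from some rule.

TieRule : ℕ → Set
TieRule m = Subset m → Fin m → Fin m → Bool

-- The index outside C with the largest gain, and that gain.

bestᵗ : (Fin m → Fin m → Bool) → Subset m → Vec ℕ m →
        Timed (Maybe (Fin m × ℕ))
bestᵗ prefer []      []       = do tick; return nothing
bestᵗ prefer (c ∷ C) (g ∷ gs) = do
  tick
  b ← bestᵗ (λ i j → prefer (suc i) (suc j)) C gs
  return (update c b)
  where
  update : Side → Maybe (Fin _ × ℕ) → Maybe (Fin _ × ℕ)
  update inside  nothing        = nothing
  update inside  (just (j , h)) = just (suc j , h)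
  update outside nothing        = just (zero , g)
  update outside (just (j , h)) =
    if h <ᵇ g then just (zero , g) else
    if g <ᵇ h then just (suc j , h) else
    if prefer zero (suc j) then just (zero , g) else just (suc j , h)

greedyStepᵗ : TieRule m → Family n m → Subset m → Timed (Subset m)
greedyStepᵗ tie 𝒮 C = do
  tick
  V     ← coveredᵗ 𝒮 C
  gains ← mapᵗ (λ S → do D ← S ∖ᵗ V; sizeᵗ D) 𝒮
  b     ← bestᵗ (tie C) C gains
  return (add b)
  where
  add : Maybe (Fin _ × ℕ) → Subset _
  add nothing        = C
  add (just (i , _)) = C [ i ]≔ inside

greedyᵗ : TieRule m → Family n m → ℕ → Timed (Subset m)
greedyᵗ tie 𝒮 zero    = do tick; ∅ᵗ
greedyᵗ tie 𝒮 (suc X) = do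
  tick
  C ← greedyᵗ tie 𝒮 X
  greedyStepᵗ tie 𝒮 C

-- The subinstance passed to 𝒜 has ∣ U ∣ elements and ∣ R ∣ sets, where R
-- is the set of indices not chosen by the greedy steps: each remaining
-- set S becomes S ∩ U, written as a subset of the element set U.

A4 : Algorithm → TieRule m → Family n m → (K X : ℕ) → Timed (Subset m)
A4 𝒜 tie 𝒮 K X = do
  tick
  C   ← greedyᵗ tie 𝒮 X
  V   ← coveredᵗ 𝒮 C
  U   ← ∁ᵗ V
  R   ← ∁ᵗ C
  𝒮∖C ← selectᵗ R 𝒮
  𝒮′  ← mapᵗ (selectᵗ U) 𝒮∖C
  C′  ← 𝒜 𝒮′ (K ∸ X)
  D   ← embedᵗ R C′
  C ∪ᵗ D

-- q ^ i / i !

expTerm : ℚ → ℕ → ℚ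
expTerm q zero    = 1ℚ
expTerm q (suc i) = expTerm q i ℚ.* (q ℚ.* (+ 1 / suc i))

-- The exponential series: exp q N is the sum of the terms q ^ i / i !
-- for i < N.

exp : ℚ → (ℕ → ℚ)
exp q zero    = 0ℚ
exp q (suc N) = exp q N ℚ.+ expTerm q N

-- For a convergent sequence s, Lim s ≤ a says that its limit is at most
-- a.

Lim_≤_ : (ℕ → ℚ) → ℚ → Set
Lim s ≤ a = ∀ ε → 0ℚ ℚ.< ε → ∃ λ M → ∀ N → M ℕ.≤ N → s N ℚ.≤ a ℚ.+ ε

-- (1 - (X / K) e^(-X/K)) · opt

guarantee : (K X : ℕ) .{{_ : NonZero K}} → ℕ → (ℕ → ℚ)
guarantee K X opt N = (1ℚ ℚ.- x ℚ.* exp (ℚ.- x) N) ℚ.* (+ opt / 1)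
  where
  x : ℚ
  x = + X / K

{-# OPTIONS --safe #-}

-- With h = 1/K, each greedy step shrinks the deficit OPT - c by the factor
-- 1 - h, so that the greedy phase leaves a deficit of at most
-- (1 - h)^X · OPT.  Of the K sets of an optimal solution, some K - X cover
-- at least the fraction 1 - X/K of the elements that the solution covers
-- and the greedy phase does not, and the exact phase is at least as good.
-- Hence the final deficit is at most (X/K)(1 - h)^X · OPT.
--
-- To compare (1 - h)^X with e^(-Xh), expand the former by the binomial
-- theorem.  The absolute values of the terms of the two series differ by
-- d i ≥ 0, where d 0 = d 1 = 0 and d decreases from i = 2 on.  So the
-- difference of the partial sums is an alternating sum of decreasing
-- terms that starts with a plus sign, and even the partial sums of the
-- exponential series are at least (1 - h)^X from X + 2 terms on.

module Submission where

open import Defs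
open import Data.Bool.Base using (Bool; true; false)
open import Data.Fin.Base using (Fin; zero; suc)
open import Data.Fin.Subset using (Subset; inside; outside; ∣_∣; _∪_; _─_; ∁; _⊆_; _∈_; _∉_)
open import Data.Fin.Subset.Properties
open import Data.Integer.Base as ℤ using (+_)
import Data.Integer.Properties as ℤₚ
open import Data.Maybe.Base using (Maybe; just; nothing)
open import Data.Nat.Base as ℕ using (ℕ; zero; suc; z≤n; s≤s)
import Data.Nat.Properties as ℕₚ
open import Data.Nat.Solver using (module +-*-Solver)
open import Data.Product.Base using (Σ; ∃; _×_; _,_; proj₁; proj₂)
import Data.Rational.Unnormalised.Base as ℚᵘ
import Data.Rational.Unnormalised.Properties as ℚᵘₚ
open import Data.Sum.Base as Sum using (_⊎_; inj₁; inj₂)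
open import Data.Vec.Base using (Vec; []; _∷_; here; there; lookup; map; replicate; _[_]≔_)
open import Data.Vec.Properties using (map-cong; lookup-map)
open import Function.Base using (_∘_)
open import Level using (0ℓ)
open import Relation.Binary.PropositionalEquality
open import Relation.Nullary using (yes; no; ofʸ; ofⁿ; contradiction)
open import Relation.Nullary.Decidable using (dec⇒maybe)
open import Tactic.RingSolver using (solve-∀)
open import Tactic.RingSolver.Core.AlmostCommutativeRing
  using (AlmostCommutativeRing; fromCommutativeRing)

-- Arithmetic in ℚ, the exponential series, and the recursion for the deficit.

module ExponentialBound where

  open import Data.Rational.Base
  open import Data.Rational.Properties

  ℚ-ring : AlmostCommutativeRing 0ℓ 0ℓ
  ℚ-ring = fromCommutativeRing +-*-commutativeRing λ x → dec⇒maybe (0ℚ ≟ x)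

  0≤p+q : ∀ {p q} → 0ℚ ≤ p → 0ℚ ≤ q → 0ℚ ≤ p + q
  0≤p+q = +-mono-≤

  0≤p*q : ∀ {p q} → 0ℚ ≤ p → 0ℚ ≤ q → 0ℚ ≤ p * q
  0≤p*q {p} {q} 0≤p 0≤q =
    subst (_≤ p * q) (*-zeroʳ p) (*-monoˡ-≤-nonNeg p {{nonNegative 0≤p}} 0≤q)

  q-p+p : ∀ p q → q - p + p ≡ q
  q-p+p = solve-∀ ℚ-ring

  p≤q⇒0≤q-p : ∀ {p q} → p ≤ q → 0ℚ ≤ q - p
  p≤q⇒0≤q-p {p} {q} p≤q = subst (_≤ q - p) (+-inverseʳ p) (+-monoˡ-≤ (- p) p≤q)

  0≤q-p⇒p≤q : ∀ {p q} → 0ℚ ≤ q - p → p ≤ q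
  0≤q-p⇒p≤q {p} {q} 0≤q-p =
    subst₂ _≤_ (+-identityˡ p) (q-p+p p q) (+-monoˡ-≤ p 0≤q-p)

  -- The embedding of ℕ in ℚ

  ι : ℕ → ℚ
  ι n = + n / 1

  -- A rational is stored in lowest terms, so `i / suc n` does not compute for variable arguments.
  -- Equations between quotients are therefore checked by cross-multiplication on unnormalised
  -- representatives and carried back by `toℚᵘ-injective`.
  toℚᵘ-/ : ∀ i n → toℚᵘ (i / suc n) ℚᵘ.≃ ℚᵘ.mkℚᵘ i n
  toℚᵘ-/ i n = toℚᵘ-fromℚᵘ (ℚᵘ.mkℚᵘ i n)

  ι-+ : ∀ m n → ι (m ℕ.+ n) ≡ ι m + ι n
  ι-+ m n = toℚᵘ-injective (begin
    toℚᵘ (ι (m ℕ.+ n))             ≈⟨ toℚᵘ-/ (+ (m ℕ.+ n)) 0 ⟩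
    ℚᵘ.mkℚᵘ (+ (m ℕ.+ n)) 0        ≈⟨ ℚᵘ.*≡* (cong (ℤ._* (+ 1)) (sym
      (cong₂ ℤ._+_ (ℤₚ.*-identityʳ (+ m)) (ℤₚ.*-identityʳ (+ n))))) ⟩
    ℚᵘ.mkℚᵘ (+ m) 0 ℚᵘ.+ ℚᵘ.mkℚᵘ (+ n) 0 ≈⟨ ℚᵘₚ.+-cong (toℚᵘ-/ (+ m) 0) (toℚᵘ-/ (+ n) 0) ⟨
    toℚᵘ (ι m) ℚᵘ.+ toℚᵘ (ι n)     ≈⟨ toℚᵘ-homo-+ (ι m) (ι n) ⟨
    toℚᵘ (ι m + ι n)               ∎)
    where open ℚᵘₚ.≃-Reasoning

  ι-suc : ∀ n → ι (suc n) ≡ 1ℚ + ι n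
  ι-suc n = ι-+ 1 n

  ι-* : ∀ m n → ι (m ℕ.* n) ≡ ι m * ι n
  ι-* zero    n = sym (*-zeroˡ (ι n))
  ι-* (suc m) n = begin
    ι (n ℕ.+ m ℕ.* n)    ≡⟨ ι-+ n (m ℕ.* n) ⟩
    ι n + ι (m ℕ.* n)    ≡⟨ cong (λ p → ι n + p) (ι-* m n) ⟩
    ι n + ι m * ι n      ≡⟨ lemma (ι m) (ι n) ⟩
    (1ℚ + ι m) * ι n     ≡⟨ cong (_* ι n) (ι-suc m) ⟨
    ι (suc m) * ι n      ∎
    where
    open ≡-Reasoning
    lemma : ∀ m n → n + m * n ≡ (1ℚ + m) * n
    lemma = solve-∀ ℚ-ring

  0≤/ : ∀ m n → 0ℚ ≤ + m / suc n
  0≤/ m n = nonNegative⁻¹ _ {{normalize-nonNeg m (suc n)}}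

  ι-mono-≤ : ∀ {m n} → m ℕ.≤ n → ι m ≤ ι n
  ι-mono-≤ {m} {n} m≤n = subst₂ _≤_ (+-identityʳ (ι m))
    (trans (sym (ι-+ m (n ℕ.∸ m))) (cong ι (ℕₚ.m+[n∸m]≡n m≤n)))
    (+-monoʳ-≤ (ι m) (0≤/ (n ℕ.∸ m) 0))

  -- Brings X/K into the form Xh with h = 1/K, so that the ring solver can treat h as a single
  -- indeterminate.
  m/n≡m*1/n : ∀ m n → + m / suc n ≡ ι m * (+ 1 / suc n)
  m/n≡m*1/n m n = toℚᵘ-injective (begin
    toℚᵘ (+ m / suc n)                     ≈⟨ toℚᵘ-/ (+ m) n ⟩
    ℚᵘ.mkℚᵘ (+ m) n                        ≈⟨ ℚᵘ.*≡*
      (cong₂ ℤ._*_ (sym (ℤₚ.*-identityʳ (+ m))) (cong (λ k → + suc k) (ℕₚ.+-identityʳ n))) ⟩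
    ℚᵘ.mkℚᵘ (+ m) 0 ℚᵘ.* ℚᵘ.mkℚᵘ (+ 1) n   ≈⟨ ℚᵘₚ.*-cong (toℚᵘ-/ (+ m) 0) (toℚᵘ-/ (+ 1) n) ⟨
    toℚᵘ (ι m) ℚᵘ.* toℚᵘ (+ 1 / suc n)     ≈⟨ toℚᵘ-homo-* (ι m) (+ 1 / suc n) ⟨
    toℚᵘ (ι m * (+ 1 / suc n))             ∎)
    where open ℚᵘₚ.≃-Reasoning

  n/n≡1 : ∀ n → ι (suc n) * (+ 1 / suc n) ≡ 1ℚ
  n/n≡1 n = trans (sym (m/n≡m*1/n (suc n) n)) (toℚᵘ-injective (begin
    toℚᵘ (+ suc n / suc n)  ≈⟨ toℚᵘ-/ (+ suc n) n ⟩
    ℚᵘ.mkℚᵘ (+ suc n) n     ≈⟨ ℚᵘ.*≡* (ℤₚ.*-comm (+ suc n) (+ 1)) ⟩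
    toℚᵘ 1ℚ                 ∎))
    where open ℚᵘₚ.≃-Reasoning

  -- (1 - h)^X ≤ e^(-Xh)

  infixr 8 _^_

  _^_ : ℚ → ℕ → ℚ
  q ^ zero  = 1ℚ
  q ^ suc n = q * q ^ n

  sign : ℕ → ℚ
  sign zero    = 1ℚ
  sign (suc i) = - sign i

  -- With the sign split off, the exponential and the binomial series share the factor `sign i`, and
  -- their nonnegative absolute terms can be compared.
  expTerm-neg : ∀ x i → expTerm (- x) i ≡ sign i * expTerm x i
  expTerm-neg x zero    = refl
  expTerm-neg x (suc i) =
    trans (cong (_* (- x * (+ 1 / suc i))) (expTerm-neg x i))
          (lemma (sign i) (expTerm x i) x (+ 1 / suc i))
    where
    lemma : ∀ s a x r → s * a * (- x * r) ≡ - s * (a * (x * r))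
    lemma = solve-∀ ℚ-ring

  -- binTerm h n i is the binomial coefficient n choose i times hⁱ.

  binTerm : ℚ → ℕ → ℕ → ℚ
  binTerm h n       zero    = 1ℚ
  binTerm h zero    (suc i) = 0ℚ
  binTerm h (suc n) (suc i) = binTerm h n (suc i) + h * binTerm h n i

  -- Partial sums of the binomial expansion of (1 - h)^n, truncated independently of n to match the
  -- partial sums of `exp`.
  binSum : ℚ → ℕ → ℕ → ℚ
  binSum h n zero    = 0ℚ
  binSum h n (suc N) = binSum h n N + sign N * binTerm h n N

  0≤binTerm : ∀ {h} → 0ℚ ≤ h → ∀ n i → 0ℚ ≤ binTerm h n i
  0≤binTerm 0≤h n       zero    = 0≤/ 1 0
  0≤binTerm 0≤h zero    (suc i) = ≤-refl
  0≤binTerm 0≤h (suc n) (suc i) =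
    0≤p+q (0≤binTerm 0≤h n (suc i)) (0≤p*q 0≤h (0≤binTerm 0≤h n i))

  binTerm≡0 : ∀ h {n i} → n ℕ.< i → binTerm h n i ≡ 0ℚ
  binTerm≡0 h {zero}  {suc i} _         = refl
  binTerm≡0 h {suc n} {suc i} (s≤s n<i) =
    trans (cong₂ (λ p q → p + h * q) (binTerm≡0 h (ℕₚ.m<n⇒m<1+n n<i)) (binTerm≡0 h n<i))
          (trans (+-identityˡ (h * 0ℚ)) (*-zeroʳ h))

  -- Pascal's rule, summed with signs: the second summand of the rule has its index shifted by one,
  -- which flips the sign and ends that sum one term earlier.
  binSum-suc : ∀ h n N → binSum h (suc n) (suc N) ≡ binSum h n (suc N) - h * binSum h n N
  binSum-suc h n zero    = lemma h
    where
    lemma : ∀ h → 0ℚ + 1ℚ * 1ℚ ≡ 0ℚ + 1ℚ * 1ℚ - h * 0ℚ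
    lemma = solve-∀ ℚ-ring
  binSum-suc h n (suc N) =
    trans (cong (_+ - sign N * (binTerm h n (suc N) + h * binTerm h n N)) (binSum-suc h n N))
          (lemma h (sign N) (binSum h n (suc N)) (binSum h n N) (binTerm h n (suc N)) (binTerm h n N))
    where
    lemma : ∀ h s S S′ b b′ →
            S - h * S′ + - s * (b + h * b′) ≡ S + - s * b - h * (S′ + s * b′)
    lemma = solve-∀ ℚ-ring

  -- As n < N, both partial sums on the right of `binSum-suc` are already complete, so each equals
  -- (1 - h)^n by induction.
  binomial : ∀ h n N → n ℕ.< N → binSum h n N ≡ (1ℚ - h) ^ n
  binomial h zero (suc zero) _ = refl
  binomial h zero (suc (suc N)) _ =
    trans (cong₂ _+_ (binomial h zero (suc N) (s≤s z≤n)) (*-zeroʳ (sign (suc N)))) refl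
  binomial h (suc n) (suc N) (s≤s n<N) = begin
    binSum h (suc n) (suc N)               ≡⟨ binSum-suc h n N ⟩
    binSum h n (suc N) - h * binSum h n N  ≡⟨ cong₂ (λ p q → p - h * q)
      (binomial h n (suc N) (ℕₚ.m<n⇒m<1+n n<N)) (binomial h n N n<N) ⟩
    (1ℚ - h) ^ n - h * (1ℚ - h) ^ n        ≡⟨ lemma h ((1ℚ - h) ^ n) ⟩
    (1ℚ - h) * (1ℚ - h) ^ n                ∎
    where
    open ≡-Reasoning
    lemma : ∀ h p → p - h * p ≡ (1ℚ - h) * p
    lemma = solve-∀ ℚ-ring

  -- The absorption identity (i + 1) C(n, i + 1) = (n - i) C(n, i), weighted by powers of h and
  -- derived from Pascal's rule by induction on n. The factor n - i is taken in ℚ, so i > n is no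
  -- special case: the terms there are 0.
  binTerm-absorb : ∀ h n i → ι (suc i) * binTerm h n (suc i) ≡ (ι n - ι i) * h * binTerm h n i
  binTerm-absorb h zero    zero    = lemma h
    where
    lemma : ∀ h → 1ℚ * 0ℚ ≡ (0ℚ - 0ℚ) * h * 1ℚ
    lemma = solve-∀ ℚ-ring
  binTerm-absorb h zero    (suc i) = lemma (ι (suc (suc i))) ((ι 0 - ι (suc i)) * h)
    where
    lemma : ∀ p q → p * 0ℚ ≡ q * 0ℚ
    lemma = solve-∀ ℚ-ring
  binTerm-absorb h (suc n) zero    = begin
    1ℚ * (binTerm h n 1 + h * 1ℚ)  ≡⟨ lemma₁ (binTerm h n 1) h ⟩
    1ℚ * binTerm h n 1 + h         ≡⟨ cong (_+ h) (binTerm-absorb h n 0) ⟩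
    (ι n - 0ℚ) * h * 1ℚ + h        ≡⟨ lemma₂ (ι n) h ⟩
    (1ℚ + ι n - 0ℚ) * h * 1ℚ       ≡⟨ cong (λ p → (p - 0ℚ) * h * 1ℚ) (ι-suc n) ⟨
    (ι (suc n) - 0ℚ) * h * 1ℚ      ∎
    where
    open ≡-Reasoning
    lemma₁ : ∀ b h → 1ℚ * (b + h * 1ℚ) ≡ 1ℚ * b + h
    lemma₁ = solve-∀ ℚ-ring
    lemma₂ : ∀ n h → (n - 0ℚ) * h * 1ℚ + h ≡ (1ℚ + n - 0ℚ) * h * 1ℚ
    lemma₂ = solve-∀ ℚ-ring
  binTerm-absorb h (suc n) (suc i) = begin
    ι (2 ℕ.+ i) * (b₂ + h * b₁)
      ≡⟨ lemma₁ (ι (2 ℕ.+ i)) b₂ h b₁ ⟩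
    ι (2 ℕ.+ i) * b₂ + ι (2 ℕ.+ i) * (h * b₁)
      ≡⟨ cong₂ (λ p q → p + q * (h * b₁)) (binTerm-absorb h n (suc i)) (ι-suc (suc i)) ⟩
    (ι n - ι (suc i)) * h * b₁ + (1ℚ + ι (suc i)) * (h * b₁)
      ≡⟨ lemma₂ (ι n) (ι (suc i)) h b₁ ⟩
    ι n * h * b₁ + h * b₁
      ≡⟨ lemma₃ (ι n) (ι i) h b₁ ⟩
    (ι n - ι i) * h * b₁ + h * ((1ℚ + ι i) * b₁)
      ≡⟨ cong (λ p → (ι n - ι i) * h * b₁ + h * (p * b₁)) (ι-suc i) ⟨
    (ι n - ι i) * h * b₁ + h * (ι (suc i) * b₁)
      ≡⟨ cong (λ p → (ι n - ι i) * h * b₁ + h * p) (binTerm-absorb h n i) ⟩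
    (ι n - ι i) * h * b₁ + h * ((ι n - ι i) * h * b₀)
      ≡⟨ lemma₄ (ι n) (ι i) h b₁ b₀ ⟩
    (1ℚ + ι n - (1ℚ + ι i)) * h * (b₁ + h * b₀)
      ≡⟨ cong₂ (λ p q → (p - q) * h * (b₁ + h * b₀)) (ι-suc n) (ι-suc i) ⟨
    (ι (suc n) - ι (suc i)) * h * (b₁ + h * b₀)
      ∎
    where
    open ≡-Reasoning
    b₀ b₁ b₂ : ℚ
    b₀ = binTerm h n i
    b₁ = binTerm h n (suc i)
    b₂ = binTerm h n (suc (suc i))
    lemma₁ : ∀ k b h b′ → k * (b + h * b′) ≡ k * b + k * (h * b′)
    lemma₁ = solve-∀ ℚ-ring
    lemma₂ : ∀ n i h b → (n - i) * h * b + (1ℚ + i) * (h * b) ≡ n * h * b + h * b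
    lemma₂ = solve-∀ ℚ-ring
    lemma₃ : ∀ n i h b → n * h * b + h * b ≡ (n - i) * h * b + h * ((1ℚ + i) * b)
    lemma₃ = solve-∀ ℚ-ring
    lemma₄ : ∀ n i h b b′ → (n - i) * h * b + h * ((n - i) * h * b′) ≡
                            (1ℚ + n - (1ℚ + i)) * h * (b + h * b′)
    lemma₄ = solve-∀ ℚ-ring

  -- Gives `binTerm` a recursion parallel to that of `expTerm`, with (n - i) h in place of x = nh.
  binTerm-step : ∀ h n i → binTerm h n (suc i) ≡
                           (+ 1 / suc i) * ((ι n - ι i) * h * binTerm h n i)
  binTerm-step h n i = begin
    b                          ≡⟨ *-identityˡ b ⟨
    1ℚ * b                     ≡⟨ cong (_* b) (n/n≡1 i) ⟨
    ι (suc i) * r * b          ≡⟨ lemma (ι (suc i)) r b ⟩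
    r * (ι (suc i) * b)        ≡⟨ cong (r *_) (binTerm-absorb h n i) ⟩
    r * ((ι n - ι i) * h * binTerm h n i) ∎
    where
    open ≡-Reasoning
    r b : ℚ
    r = + 1 / suc i
    b = binTerm h n (suc i)
    lemma : ∀ k r b → k * r * b ≡ r * (k * b)
    lemma = solve-∀ ℚ-ring

  -- Termwise comparison of the binomial and the exponential series.

  module _ (h : ℚ) (n : ℕ) (0≤h : 0ℚ ≤ h) (nh≤1 : ι n * h ≤ 1ℚ) where

    private
      x : ℚ
      x = ι n * h

      a b d : ℕ → ℚ
      a = expTerm x
      b = binTerm h n
      d i = a i - b i

      0≤x : 0ℚ ≤ x
      0≤x = 0≤p*q (0≤/ n 0) 0≤h

      0≤b : ∀ i → 0ℚ ≤ b i
      0≤b = 0≤binTerm 0≤h n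

      d1≡0 : d 1 ≡ 0ℚ
      d1≡0 = trans (cong (λ p → a 1 - p) (binTerm-step h n 0)) (lemma (ι n) h)
        where
        lemma : ∀ n h → 1ℚ * (n * h * 1ℚ) - 1ℚ * ((n - 0ℚ) * h * 1ℚ) ≡ 0ℚ
        lemma = solve-∀ ℚ-ring

    -- The extra factor 1 + h over the plain comparison b ≤ a is what makes `d` decrease. At index 2
    -- the difference factors as xh(1 - x + h)/2, which is nonnegative because x ≤ 1. After that,
    -- each difference is x/(k + 1) times the previous one plus a nonnegative remainder.
    [1+h]binTerm≤expTerm : ∀ i → (1ℚ + h) * b (2 ℕ.+ i) ≤ a (2 ℕ.+ i)
    [1+h]binTerm≤expTerm zero = 0≤q-p⇒p≤q (subst (0ℚ ≤_)
      (sym (trans (cong (λ p → a 2 - (1ℚ + h) * p)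
                    (trans (binTerm-step h n 1)
                           (cong (λ p → ½ * ((ι n - 1ℚ) * h * p)) (binTerm-step h n 0))))
                  (lemma (ι n) h ½)))
      (0≤p*q (0≤p*q (0≤p*q (0≤/ 1 1) 0≤x) 0≤h)
             (0≤p+q (p≤q⇒0≤q-p nh≤1) 0≤h)))
      where
      lemma : ∀ n h r →
        1ℚ * (n * h * 1ℚ) * (n * h * r) -
          (1ℚ + h) * (r * ((n - 1ℚ) * h * (1ℚ * ((n - 0ℚ) * h * 1ℚ)))) ≡
        r * (n * h) * h * (1ℚ - n * h + h)
      lemma = solve-∀ ℚ-ring
    [1+h]binTerm≤expTerm (suc i) = 0≤q-p⇒p≤q (subst (0ℚ ≤_)
      (sym (trans (cong (λ p → a (3 ℕ.+ i) - (1ℚ + h) * p) (binTerm-step h n (2 ℕ.+ i)))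
                  (lemma (ι n) h (ι (2 ℕ.+ i)) (+ 1 / (3 ℕ.+ i)) (a (2 ℕ.+ i)) (b (2 ℕ.+ i)))))
      (0≤p*q (0≤/ 1 (2 ℕ.+ i))
        (0≤p+q (0≤p*q 0≤x (p≤q⇒0≤q-p ([1+h]binTerm≤expTerm i)))
               (0≤p*q (0≤p*q (0≤p*q (0≤/ (2 ℕ.+ i) 0) 0≤h) (0≤p+q (0≤/ 1 0) 0≤h))
                      (0≤b (2 ℕ.+ i))))))
      where
      lemma : ∀ n h i r a b →
        a * (n * h * r) - (1ℚ + h) * (r * ((n - i) * h * b)) ≡
        r * (n * h * (a - (1ℚ + h) * b) + i * h * (1ℚ + h) * b)
      lemma = solve-∀ ℚ-ring

    private
      0≤d : ∀ i → 0ℚ ≤ d (2 ℕ.+ i)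
      0≤d i = subst (0ℚ ≤_) (lemma h (a (2 ℕ.+ i)) (b (2 ℕ.+ i)))
        (0≤p+q (p≤q⇒0≤q-p ([1+h]binTerm≤expTerm i)) (0≤p*q 0≤h (0≤b (2 ℕ.+ i))))
        where
        lemma : ∀ h a b → a - (1ℚ + h) * b + h * b ≡ a - b
        lemma = solve-∀ ℚ-ring

      -- With k = i + 2, (k + 1)(d k - d (k + 1)) = (1 - x) d k + k (a k - (1 + h) b k), and both
      -- summands are nonnegative.
      d-antitone : ∀ i → d (3 ℕ.+ i) ≤ d (2 ℕ.+ i)
      d-antitone i = 0≤q-p⇒p≤q (subst (0ℚ ≤_) (sym eq)
        (0≤p*q (0≤/ 1 k)
          (0≤p+q (0≤p*q (p≤q⇒0≤q-p nh≤1) (0≤d i))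
                 (0≤p*q (0≤/ k 0) (p≤q⇒0≤q-p ([1+h]binTerm≤expTerm i))))))
        where
        open ≡-Reasoning
        k : ℕ
        k = 2 ℕ.+ i
        r : ℚ
        r = + 1 / suc k
        lemma₁ : ∀ d d′ → d - d′ ≡ 1ℚ * d - d′
        lemma₁ = solve-∀ ℚ-ring
        lemma₂ : ∀ n h k r a b →
          (1ℚ + k) * r * (a - b) - (a * (n * h * r) - r * ((n - k) * h * b)) ≡
          r * ((1ℚ - n * h) * (a - b) + k * (a - (1ℚ + h) * b))
        lemma₂ = solve-∀ ℚ-ring
        eq : d k - d (suc k) ≡ r * ((1ℚ - x) * d k + ι k * (a k - (1ℚ + h) * b k))
        eq = begin
          d k - d (suc k)
            ≡⟨ lemma₁ (d k) (d (suc k)) ⟩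
          1ℚ * d k - d (suc k)
            -- Writing 1 as (k + 1) r lets r be factored out of the whole difference; `a (suc k)`
            -- and `b (suc k)` carry it already.
            ≡⟨ cong₂ (λ p q → p * d k - (a (suc k) - q))
                 (trans (sym (n/n≡1 k)) (cong (_* r) (ι-suc k)))
                 (binTerm-step h n k) ⟩
          (1ℚ + ι k) * r * d k - (a (suc k) - r * ((ι n - ι k) * h * b k))
            ≡⟨ lemma₂ (ι n) h (ι k) r (a k) (b k) ⟩
          r * ((1ℚ - x) * d k + ι k * (a k - (1ℚ + h) * b k)) ∎

      D : ℕ → ℚ
      D N = exp (- x) N - binSum h n N

      D-suc : ∀ N → D (suc N) ≡ D N + sign N * d N
      D-suc N = trans (cong (λ p → exp (- x) N + p - binSum h n (suc N)) (expTerm-neg x N))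
                      (lemma (exp (- x) N) (binSum h n N) (sign N) (a N) (b N))
        where
        lemma : ∀ E B s a b → E + s * a - (B + s * b) ≡ E - B + s * (a - b)
        lemma = solve-∀ ℚ-ring

      D2≡0 : D 2 ≡ 0ℚ
      D2≡0 = trans (D-suc 1) (cong (λ p → 0ℚ + -1ℚ * p) d1≡0)
        where
        -1ℚ : ℚ
        -1ℚ = - 1ℚ

      -- Here `sign N` is the sign of the term added next. Adding d N to a nonnegative sum leaves at
      -- least d N, hence at least d (N + 1), in reserve for the subtraction that follows.
      alternating : ∀ j → let N = 2 ℕ.+ j in
        (sign N ≡ 1ℚ × 0ℚ ≤ D N) ⊎ (sign N ≡ - 1ℚ × d N ≤ D N)
      alternating zero = inj₁ (refl , ≤-reflexive (sym D2≡0))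
      alternating (suc j) with alternating j
      ... | inj₁ (s≡1 , 0≤D) = inj₂ (cong -_ s≡1 , ≤-trans (d-antitone j)
        (0≤q-p⇒p≤q (subst (0ℚ ≤_) (sym eq) 0≤D)))
        where
        N : ℕ
        N = 2 ℕ.+ j
        lemma : ∀ D d → D + 1ℚ * d - d ≡ D
        lemma = solve-∀ ℚ-ring
        eq : D (suc N) - d N ≡ D N
        eq = trans (cong (_- d N) (trans (D-suc N) (cong (λ s → D N + s * d N) s≡1)))
                   (lemma (D N) (d N))
      ... | inj₂ (s≡-1 , d≤D) = inj₁ (cong -_ s≡-1 ,
        subst (0ℚ ≤_) (sym eq) (p≤q⇒0≤q-p d≤D))
        where
        N : ℕ
        N = 2 ℕ.+ j
        lemma : ∀ D d → D + - 1ℚ * d ≡ D - d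
        lemma = solve-∀ ℚ-ring
        eq : D (suc N) ≡ D N - d N
        eq = trans (D-suc N) (trans (cong (λ s → D N + s * d N) s≡-1) (lemma (D N) (d N)))

      0≤D : ∀ j → 0ℚ ≤ D (2 ℕ.+ j)
      0≤D j with alternating j
      ... | inj₁ (_ , 0≤DN) = 0≤DN
      ... | inj₂ (_ , d≤DN) = ≤-trans (0≤d j) d≤DN

    -- N > n makes the binomial sum complete, and N ≥ 2 is where the alternating argument starts; 2
    -- + n secures both.
    [1-h]^n≤exp : ∀ {N} → 2 ℕ.+ n ℕ.≤ N → (1ℚ - h) ^ n ≤ exp (- x) N
    [1-h]^n≤exp {suc (suc j)} (s≤s (s≤s n≤j)) = subst (_≤ exp (- x) (2 ℕ.+ j))
      (binomial h n (2 ℕ.+ j) (s≤s (ℕₚ.m≤n⇒m≤1+n n≤j)))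
      (0≤q-p⇒p≤q (0≤D j))

  -- Here K = suc k, ω is the optimum, c i the coverage after i greedy steps
  -- and t the final coverage.

  deficit-bound : ∀ k X ω (c : ℕ → ℕ) t → X ℕ.≤ suc k →
    (∀ i → i ℕ.< X → ω ℕ.+ suc k ℕ.* c i ℕ.≤ suc k ℕ.* c (suc i) ℕ.+ c i) →
    (suc k ℕ.∸ X) ℕ.* ω ℕ.+ X ℕ.* c X ℕ.≤ suc k ℕ.* t →
    Lim guarantee (suc k) X ω ≤ ι t
  deficit-bound k X ω c t X≤K greedy last ε 0<ε = 2 ℕ.+ X , λ N 2+X≤N →
    -- The bound already holds without ε for all N ≥ 2 + X, the threshold of `[1-h]^n≤exp`; ε is
    -- merely added on the right.
    ≤-trans (subst (λ x → (1ℚ - x * exp (- x) N) * ι ω ≤ ι t) (sym (m/n≡m*1/n X k)) (bound N 2+X≤N))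
            (subst (_≤ ι t + ε) (+-identityʳ (ι t)) (+-monoʳ-≤ (ι t) (<⇒≤ 0<ε)))
    where
    h q : ℚ
    h = + 1 / suc k
    q = 1ℚ - h

    0≤h : 0ℚ ≤ h
    0≤h = 0≤/ 1 k

    *h-mono : ∀ {m n} → m ℕ.≤ n → ι m * h ≤ ι n * h
    *h-mono m≤n = *-monoʳ-≤-nonNeg h {{nonNegative 0≤h}} (ι-mono-≤ m≤n)

    Kh≡1 : ι (suc k) * h ≡ 1ℚ
    Kh≡1 = n/n≡1 k

    Xh≤1 : ι X * h ≤ 1ℚ
    Xh≤1 = subst (ι X * h ≤_) Kh≡1 (*h-mono X≤K)

    h≤1 : h ≤ 1ℚ
    h≤1 = subst₂ _≤_ (*-identityˡ h) Kh≡1 (*h-mono (s≤s (z≤n {k})))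

    -- The hypothesis `greedy`, multiplied by h = 1/K and rearranged into a contraction of the
    -- deficit.
    step : ∀ i → i ℕ.< X → ι ω - ι (c (suc i)) ≤ q * (ι ω - ι (c i))
    step i i<X = 0≤q-p⇒p≤q (subst (0ℚ ≤_) eq (p≤q⇒0≤q-p (*h-mono (greedy i i<X))))
      where
      lemma₁ : ∀ h K ω c c′ → (K * c′ + c) * h - (ω + K * c) * h ≡
                                K * h * c′ + c * h - (ω * h + K * h * c)
      lemma₁ = solve-∀ ℚ-ring
      lemma₂ : ∀ h ω c c′ → 1ℚ * c′ + c * h - (ω * h + 1ℚ * c) ≡ (1ℚ - h) * (ω - c) - (ω - c′)
      lemma₂ = solve-∀ ℚ-ring
      ι-+* : ∀ l m n → ι (l ℕ.+ m ℕ.* n) ≡ ι l + ι m * ι n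
      ι-+* l m n = trans (ι-+ l (m ℕ.* n)) (cong (λ p → ι l + p) (ι-* m n))
      ι-*+ : ∀ l m n → ι (m ℕ.* n ℕ.+ l) ≡ ι m * ι n + ι l
      ι-*+ l m n = trans (ι-+ (m ℕ.* n) l) (cong (_+ ι l) (ι-* m n))
      open ≡-Reasoning
      eq : ι (suc k ℕ.* c (suc i) ℕ.+ c i) * h - ι (ω ℕ.+ suc k ℕ.* c i) * h ≡
           q * (ι ω - ι (c i)) - (ι ω - ι (c (suc i)))
      eq = begin
        ι (suc k ℕ.* c (suc i) ℕ.+ c i) * h - ι (ω ℕ.+ suc k ℕ.* c i) * h
          ≡⟨ cong₂ (λ p q → p * h - q * h) (ι-*+ (c i) (suc k) (c (suc i))) (ι-+* ω (suc k) (c i)) ⟩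
        (ι (suc k) * ι (c (suc i)) + ι (c i)) * h - (ι ω + ι (suc k) * ι (c i)) * h
          ≡⟨ lemma₁ h (ι (suc k)) (ι ω) (ι (c i)) (ι (c (suc i))) ⟩
        ι (suc k) * h * ι (c (suc i)) + ι (c i) * h - (ι ω * h + ι (suc k) * h * ι (c i))
          ≡⟨ cong (λ p → p * ι (c (suc i)) + ι (c i) * h - (ι ω * h + p * ι (c i))) Kh≡1 ⟩
        1ℚ * ι (c (suc i)) + ι (c i) * h - (ι ω * h + 1ℚ * ι (c i))
          ≡⟨ lemma₂ h (ι ω) (ι (c i)) (ι (c (suc i))) ⟩
        q * (ι ω - ι (c i)) - (ι ω - ι (c (suc i))) ∎

    deficit : ∀ i → i ℕ.≤ X → ι ω - ι (c i) ≤ q ^ i * ι ω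
    deficit zero    _   = 0≤q-p⇒p≤q (subst (0ℚ ≤_) (lemma (ι ω) (ι (c 0))) (0≤/ (c 0) 0))
      where
      lemma : ∀ ω c → c ≡ 1ℚ * ω - (ω - c)
      lemma = solve-∀ ℚ-ring
    deficit (suc i) i<X = ≤-trans (step i i<X)
      (subst (q * (ι ω - ι (c i)) ≤_) (sym (*-assoc q (q ^ i) (ι ω)))
        (*-monoˡ-≤-nonNeg q {{nonNegative (p≤q⇒0≤q-p h≤1)}} (deficit i (ℕₚ.<⇒≤ i<X))))

    bound : ∀ N → 2 ℕ.+ X ℕ.≤ N → (1ℚ - ι X * h * exp (- (ι X * h)) N) * ι ω ≤ ι t
    -- The slack splits into h times the slack of `last`, plus Xh times the sum of the slack of
    -- `deficit` at X and ω times the slack of `[1-h]^n≤exp`.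
    bound N 2+X≤N = 0≤q-p⇒p≤q (subst (0ℚ ≤_) (sym eq)
      (0≤p+q (p≤q⇒0≤q-p (*h-mono last))
        (0≤p*q (0≤p*q (0≤/ X 0) 0≤h)
          (0≤p+q (p≤q⇒0≤q-p (deficit X ℕₚ.≤-refl))
                 (0≤p*q (p≤q⇒0≤q-p ([1-h]^n≤exp h X 0≤h Xh≤1 2+X≤N)) (0≤/ ω 0))))))
      where
      E : ℚ
      E = exp (- (ι X * h)) N
      L : ℕ
      L = suc k ℕ.∸ X
      rest : ℚ
      rest = ι X * h * (q ^ X * ι ω - (ι ω - ι (c X)) + (E - q ^ X) * ι ω)
      lemma₁ : ∀ K L X h t ω c r → (K * t) * h - (L * ω + X * c) * h + r ≡
                                   K * h * t - ((L + X) * h * ω - X * h * ω + X * h * c) + r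
      lemma₁ = solve-∀ ℚ-ring
      lemma₂ : ∀ X h t ω c E Q → t - (1ℚ - X * h * E) * ω ≡
        1ℚ * t - (1ℚ * ω - X * h * ω + X * h * c) + X * h * (Q * ω - (ω - c) + (E - Q) * ω)
      lemma₂ = solve-∀ ℚ-ring
      open ≡-Reasoning
      eq : ι t - (1ℚ - ι X * h * E) * ι ω ≡
           ι (suc k ℕ.* t) * h - ι (L ℕ.* ω ℕ.+ X ℕ.* c X) * h + rest
      eq = begin
        ι t - (1ℚ - ι X * h * E) * ι ω
          ≡⟨ lemma₂ (ι X) h (ι t) (ι ω) (ι (c X)) E (q ^ X) ⟩
        1ℚ * ι t - (1ℚ * ι ω - ι X * h * ι ω + ι X * h * ι (c X)) + rest
          -- The two factors 1 become Kh and (L + X)h, as the terms of `last` require.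
          ≡⟨ cong₂ (λ u v → u * ι t - (v * ι ω - ι X * h * ι ω + ι X * h * ι (c X)) + rest) Kh≡1
               (trans (cong (_* h) (trans (sym (ι-+ L X)) (cong ι (ℕₚ.m∸n+n≡m X≤K)))) Kh≡1) ⟨
        ι (suc k) * h * ι t - ((ι L + ι X) * h * ι ω - ι X * h * ι ω + ι X * h * ι (c X)) + rest
          ≡⟨ lemma₁ (ι (suc k)) (ι L) (ι X) h (ι t) (ι ω) (ι (c X)) rest ⟨
        ι (suc k) * ι t * h - (ι L * ι ω + ι X * ι (c X)) * h + rest
          ≡⟨ cong₂ (λ u v → u * h - v * h + rest) (ι-* (suc k) t)
               (trans (ι-+ (L ℕ.* ω) (X ℕ.* c X)) (cong₂ _+_ (ι-* L ω) (ι-* X (c X)))) ⟨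
        ι (suc k ℕ.* t) * h - ι (L ℕ.* ω ℕ.+ X ℕ.* c X) * h + rest ∎

open import Data.Nat.Base hiding (_/_; zero; suc; z≤n; s≤s; ℕ)
open import Data.Nat.Properties
open import Data.Rational.Base using (_/_)
import Data.Nat.Tactic.RingSolver as ℕ-Solver

private
  variable
    A B : Set
    m n : ℕ

-- Sizes of subsets

∣p∪q∣≡∣q∣+∣p─q∣ : (p q : Subset n) → ∣ p ∪ q ∣ ≡ ∣ q ∣ + ∣ p ─ q ∣
∣p∪q∣≡∣q∣+∣p─q∣ []            []            = refl
∣p∪q∣≡∣q∣+∣p─q∣ (inside  ∷ p) (inside  ∷ q) = cong suc (∣p∪q∣≡∣q∣+∣p─q∣ p q)
∣p∪q∣≡∣q∣+∣p─q∣ (inside  ∷ p) (outside ∷ q) =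
  trans (cong suc (∣p∪q∣≡∣q∣+∣p─q∣ p q)) (sym (+-suc ∣ q ∣ ∣ p ─ q ∣))
∣p∪q∣≡∣q∣+∣p─q∣ (outside ∷ p) (inside  ∷ q) = cong suc (∣p∪q∣≡∣q∣+∣p─q∣ p q)
∣p∪q∣≡∣q∣+∣p─q∣ (outside ∷ p) (outside ∷ q) = ∣p∪q∣≡∣q∣+∣p─q∣ p q

∣p∣≤∣q∣+∣p─q∣ : (p q : Subset n) → ∣ p ∣ ≤ ∣ q ∣ + ∣ p ─ q ∣
∣p∣≤∣q∣+∣p─q∣ p q = ≤-trans (∣p∣≤∣p∪q∣ p q) (≤-reflexive (∣p∪q∣≡∣q∣+∣p─q∣ p q))

∣p∪q∣≤∣p∣+∣q∣ : (p q : Subset n) → ∣ p ∪ q ∣ ≤ ∣ p ∣ + ∣ q ∣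
∣p∪q∣≤∣p∣+∣q∣ p q = begin
  ∣ p ∪ q ∣         ≡⟨ ∣p∪q∣≡∣q∣+∣p─q∣ p q ⟩
  ∣ q ∣ + ∣ p ─ q ∣ ≤⟨ +-monoʳ-≤ ∣ q ∣ (∣p─q∣≤∣p∣ p q) ⟩
  ∣ q ∣ + ∣ p ∣     ≡⟨ +-comm ∣ q ∣ ∣ p ∣ ⟩
  ∣ p ∣ + ∣ q ∣     ∎
  where open ≤-Reasoning

x∈p─q⇒x∉q : ∀ {x} (p q : Subset n) → x ∈ p ─ q → x ∉ q
x∈p─q⇒x∉q (_ ∷ p) (inside  ∷ q) ()        here
x∈p─q⇒x∉q (_ ∷ p) (_       ∷ q) (there i) (there j) = x∈p─q⇒x∉q p q i j

-- It is enough that `p` lies in `p′` up to elements of `q′`, since those are removed anyway. In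
-- this form it applies to an optimal cover of which only the sets outside the greedy choice are
-- retained.
─-mono : (p p′ q q′ : Subset n) → p ⊆ p′ ∪ q′ → q′ ⊆ q → p ─ q ⊆ p′ ─ q′
─-mono p p′ q q′ p⊆p′∪q′ q′⊆q x∈p─q with x∈p∪q⁻ p′ q′ (p⊆p′∪q′ (p─q⊆p p q x∈p─q))
... | inj₁ x∈p′ = x∈p∧x∉q⇒x∈p─q x∈p′ (x∈p─q⇒x∉q p q x∈p─q ∘ q′⊆q)
... | inj₂ x∈q′ = contradiction (q′⊆q x∈q′) (x∈p─q⇒x∉q p q x∈p─q)

p⊆q⇒∣p─q∣≡0 : (p q : Subset n) → p ⊆ q → ∣ p ─ q ∣ ≡ 0
p⊆q⇒∣p─q∣≡0 []            []            _   = refl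
p⊆q⇒∣p─q∣≡0 (inside  ∷ p) (inside  ∷ q) p⊆q = p⊆q⇒∣p─q∣≡0 p q (drop-∷-⊆ p⊆q)
p⊆q⇒∣p─q∣≡0 (inside  ∷ p) (outside ∷ q) p⊆q with () ← p⊆q here
p⊆q⇒∣p─q∣≡0 (outside ∷ p) (inside  ∷ q) p⊆q = p⊆q⇒∣p─q∣≡0 p q (drop-∷-⊆ p⊆q)
p⊆q⇒∣p─q∣≡0 (outside ∷ p) (outside ∷ q) p⊆q = p⊆q⇒∣p─q∣≡0 p q (drop-∷-⊆ p⊆q)

p∪q─r≡[p─r]∪[q─r] : (p q r : Subset n) → (p ∪ q) ─ r ≡ (p ─ r) ∪ (q ─ r)
p∪q─r≡[p─r]∪[q─r] []      []      []            = refl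
p∪q─r≡[p─r]∪[q─r] (_ ∷ p) (_ ∷ q) (inside  ∷ r) = cong (_ ∷_) (p∪q─r≡[p─r]∪[q─r] p q r)
p∪q─r≡[p─r]∪[q─r] (_ ∷ p) (_ ∷ q) (outside ∷ r) = cong (_ ∷_) (p∪q─r≡[p─r]∪[q─r] p q r)

∣p[i]≔inside∣≤1+∣p∣ : (p : Subset n) (i : Fin n) → ∣ p [ i ]≔ inside ∣ ≤ suc ∣ p ∣
∣p[i]≔inside∣≤1+∣p∣ (inside  ∷ p) zero    = n≤1+n _
∣p[i]≔inside∣≤1+∣p∣ (outside ∷ p) zero    = ≤-refl
∣p[i]≔inside∣≤1+∣p∣ (inside  ∷ p) (suc i) = s≤s (∣p[i]≔inside∣≤1+∣p∣ p i)
∣p[i]≔inside∣≤1+∣p∣ (outside ∷ p) (suc i) = ∣p[i]≔inside∣≤1+∣p∣ p i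

-- select and embedᵗ

embed : (p : Subset n) → Subset ∣ p ∣ → Subset n
embed p q = value (embedᵗ p q)

∣embed∣ : (p : Subset n) (q : Subset ∣ p ∣) → ∣ embed p q ∣ ≡ ∣ q ∣
∣embed∣ []            []            = refl
∣embed∣ (inside  ∷ p) (inside  ∷ q) = cong suc (∣embed∣ p q)
∣embed∣ (inside  ∷ p) (outside ∷ q) = ∣embed∣ p q
∣embed∣ (outside ∷ p) q             = ∣embed∣ p q

∣select∣≤ : (p q : Subset n) → ∣ select p q ∣ ≤ ∣ q ∣
∣select∣≤ []            []            = z≤n
∣select∣≤ (inside  ∷ p) (inside  ∷ q) = s≤s (∣select∣≤ p q)
∣select∣≤ (inside  ∷ p) (outside ∷ q) = ∣select∣≤ p q
∣select∣≤ (outside ∷ p) (x       ∷ q) = ≤-trans (∣select∣≤ p q) (∣p∣≤∣x∷p∣ x q)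

∣select-∁∣ : (p q : Subset n) → ∣ select (∁ p) q ∣ ≡ ∣ q ─ p ∣
∣select-∁∣ []            []            = refl
∣select-∁∣ (inside  ∷ p) (_       ∷ q) = ∣select-∁∣ p q
∣select-∁∣ (outside ∷ p) (inside  ∷ q) = cong suc (∣select-∁∣ p q)
∣select-∁∣ (outside ∷ p) (outside ∷ q) = ∣select-∁∣ p q

select-∪ : (p q r : Subset n) → select p (q ∪ r) ≡ select p q ∪ select p r
select-∪ []            []      []      = refl
select-∪ (inside  ∷ p) (_ ∷ q) (_ ∷ r) = cong (_ ∷_) (select-∪ p q r)
select-∪ (outside ∷ p) (_ ∷ q) (_ ∷ r) = select-∪ p q r

select-⊥ : (p : Subset n) → select p (replicate n outside) ≡ replicate ∣ p ∣ outside
select-⊥ []            = refl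
select-⊥ (inside  ∷ p) = cong (outside ∷_) (select-⊥ p)
select-⊥ (outside ∷ p) = select-⊥ p

p⊆embed-select-∁∪q : (p q : Subset n) → p ⊆ embed (∁ q) (select (∁ q) p) ∪ q
p⊆embed-select-∁∪q (_ ∷ p)       (inside  ∷ q) here      = here
p⊆embed-select-∁∪q (_ ∷ p)       (outside ∷ q) here      = here
p⊆embed-select-∁∪q (_ ∷ p)       (inside  ∷ q) (there i) = there (p⊆embed-select-∁∪q p q i)
p⊆embed-select-∁∪q (_ ∷ p)       (outside ∷ q) (there i) = there (p⊆embed-select-∁∪q p q i)

-- Coverage

covered-∪ : (𝒮 : Family n m) (C D : Subset m) →
            covered 𝒮 (C ∪ D) ≡ covered 𝒮 C ∪ covered 𝒮 D
covered-∪ []      []            []            = sym (∪-idem _)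
covered-∪ (S ∷ 𝒮) (inside  ∷ C) (inside  ∷ D) = begin
  S ∪ covered 𝒮 (C ∪ D)       ≡⟨ cong (S ∪_) (covered-∪ 𝒮 C D) ⟩
  S ∪ (V ∪ W)                 ≡⟨ ∪-assoc S V W ⟨
  (S ∪ V) ∪ W                 ≡⟨ cong (λ p → (p ∪ V) ∪ W) (∪-idem S) ⟨
  ((S ∪ S) ∪ V) ∪ W           ≡⟨ cong (_∪ W) (trans (∪-assoc S S V) (∪-comm S (S ∪ V))) ⟩
  ((S ∪ V) ∪ S) ∪ W           ≡⟨ ∪-assoc (S ∪ V) S W ⟩
  (S ∪ V) ∪ (S ∪ W)           ∎
  where
  open ≡-Reasoning
  V W : Subset _
  V = covered 𝒮 C
  W = covered 𝒮 D
covered-∪ (S ∷ 𝒮) (inside  ∷ C) (outside ∷ D) =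
  trans (cong (S ∪_) (covered-∪ 𝒮 C D)) (sym (∪-assoc S (covered 𝒮 C) (covered 𝒮 D)))
covered-∪ (S ∷ 𝒮) (outside ∷ C) (inside  ∷ D) = begin
  S ∪ covered 𝒮 (C ∪ D)  ≡⟨ cong (S ∪_) (trans (covered-∪ 𝒮 C D) (∪-comm V W)) ⟩
  S ∪ (W ∪ V)            ≡⟨ ∪-assoc S W V ⟨
  (S ∪ W) ∪ V            ≡⟨ ∪-comm (S ∪ W) V ⟩
  V ∪ (S ∪ W)            ∎
  where
  open ≡-Reasoning
  V W : Subset _
  V = covered 𝒮 C
  W = covered 𝒮 D
covered-∪ (S ∷ 𝒮) (outside ∷ C) (outside ∷ D) = covered-∪ 𝒮 C D

⊆⇒∪≡ : (p q : Subset n) → p ⊆ q → p ∪ q ≡ q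
⊆⇒∪≡ p q p⊆q = ⊆-antisym
  (λ x∈p∪q → case⊎ (x∈p∪q⁻ p q x∈p∪q)) (q⊆p∪q p q)
  where
  case⊎ : ∀ {x} → x ∈ p ⊎ x ∈ q → x ∈ q
  case⊎ (inj₁ x∈p) = p⊆q x∈p
  case⊎ (inj₂ x∈q) = x∈q

covered-mono : (𝒮 : Family n m) {C D : Subset m} → C ⊆ D → covered 𝒮 C ⊆ covered 𝒮 D
covered-mono 𝒮 {C} {D} C⊆D = subst (covered 𝒮 C ⊆_)
  (trans (sym (covered-∪ 𝒮 C D)) (cong (covered 𝒮) (⊆⇒∪≡ C D C⊆D)))
  (p⊆p∪q (covered 𝒮 D))

covered-[i]≔inside : (𝒮 : Family n m) (C : Subset m) (i : Fin m) →
               covered 𝒮 (C [ i ]≔ inside) ≡ lookup 𝒮 i ∪ covered 𝒮 C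
covered-[i]≔inside (S ∷ 𝒮) (inside  ∷ C) zero    =
  trans (cong (_∪ covered 𝒮 C) (sym (∪-idem S))) (∪-assoc S S (covered 𝒮 C))
covered-[i]≔inside (S ∷ 𝒮) (outside ∷ C) zero    = refl
covered-[i]≔inside (S ∷ 𝒮) (inside  ∷ C) (suc i) = begin
  S ∪ covered 𝒮 (C [ i ]≔ inside)  ≡⟨ cong (S ∪_) (trans (covered-[i]≔inside 𝒮 C i) (∪-comm T V)) ⟩
  S ∪ (V ∪ T)                      ≡⟨ ∪-assoc S V T ⟨
  (S ∪ V) ∪ T                      ≡⟨ ∪-comm (S ∪ V) T ⟩
  T ∪ (S ∪ V)                      ∎
  where
  open ≡-Reasoning
  T V : Subset _
  T = lookup 𝒮 i
  V = covered 𝒮 C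
covered-[i]≔inside (S ∷ 𝒮) (outside ∷ C) (suc i) = covered-[i]≔inside 𝒮 C i

lookup⊆covered : (𝒮 : Family n m) {C : Subset m} {i : Fin m} → i ∈ C → lookup 𝒮 i ⊆ covered 𝒮 C
lookup⊆covered (S ∷ 𝒮) {inside ∷ C}  here        = p⊆p∪q (covered 𝒮 C)
lookup⊆covered (S ∷ 𝒮) {inside ∷ C}  (there i∈C) =
  ⊆-trans (lookup⊆covered 𝒮 i∈C) (q⊆p∪q S (covered 𝒮 C))
lookup⊆covered (S ∷ 𝒮) {outside ∷ C} (there i∈C) = lookup⊆covered 𝒮 i∈C

-- The union bound: what the sets of `D` add to `V` together is at most the sum of what each adds
-- alone.
∣covered─V∣≤ : (𝒮 : Family n m) (V : Subset n) (g : ℕ) → (∀ i → ∣ lookup 𝒮 i ─ V ∣ ≤ g) →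
               ∀ D → ∣ covered 𝒮 D ─ V ∣ ≤ ∣ D ∣ * g
∣covered─V∣≤ []      V g _   []            = ≤-reflexive (p⊆q⇒∣p─q∣≡0 _ V ⊥⊆)
∣covered─V∣≤ (S ∷ 𝒮) V g ≤g (inside  ∷ D) = begin
  ∣ (S ∪ covered 𝒮 D) ─ V ∣           ≡⟨ cong ∣_∣ (p∪q─r≡[p─r]∪[q─r] S (covered 𝒮 D) V) ⟩
  ∣ (S ─ V) ∪ (covered 𝒮 D ─ V) ∣     ≤⟨ ∣p∪q∣≤∣p∣+∣q∣ (S ─ V) (covered 𝒮 D ─ V) ⟩
  ∣ S ─ V ∣ + ∣ covered 𝒮 D ─ V ∣     ≤⟨ +-mono-≤ (≤g zero) (∣covered─V∣≤ 𝒮 V g (≤g ∘ suc) D) ⟩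
  g + ∣ D ∣ * g                       ∎
  where open ≤-Reasoning
∣covered─V∣≤ (S ∷ 𝒮) V g ≤g (outside ∷ D) = ∣covered─V∣≤ 𝒮 V g (≤g ∘ suc) D

covered-select : (p : Subset m) (𝒮 : Family n m) (q : Subset ∣ p ∣) →
                 covered (select p 𝒮) q ≡ covered 𝒮 (embed p q)
covered-select []            []      []            = refl
covered-select (inside  ∷ p) (S ∷ 𝒮) (inside  ∷ q) = cong (S ∪_) (covered-select p 𝒮 q)
covered-select (inside  ∷ p) (S ∷ 𝒮) (outside ∷ q) = covered-select p 𝒮 q
covered-select (outside ∷ p) (S ∷ 𝒮) q             = covered-select p 𝒮 q

covered-map-select : (U : Subset n) (𝒮 : Family n m) (C : Subset m) →
                     covered (map (select U) 𝒮) C ≡ select U (covered 𝒮 C)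
covered-map-select U []      []            = sym (select-⊥ U)
covered-map-select U (S ∷ 𝒮) (inside  ∷ C) =
  trans (cong (select U S ∪_) (covered-map-select U 𝒮 C)) (sym (select-∪ U S (covered 𝒮 C)))
covered-map-select U (S ∷ 𝒮) (outside ∷ C) = covered-map-select U 𝒮 C

-- The first set is kept if its marginal gain is at least the average
-- marginal gain of the later sets.

keep-or-drop : ∀ k l g G → .{{_ : NonZero k}} → l ≤ k →
  (∀ y → l * G ≤ k * y → suc l * (G + g) ≤ suc k * (y + g)) ⊎
  (∀ y → suc l * G ≤ k * y → suc l * (G + g) ≤ suc k * y)
keep-or-drop k l g G l≤k with ≤-total G (k * g)
... | inj₁ G≤kg = inj₁ λ y lG≤ky → begin
  suc l * (G + g)            ≡⟨ lemma₁ l g G ⟩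
  -- What remains is l g + G ≤ k g + y. After multiplication by k = l + j, the l copies of G are
  -- bounded by k y, and the other j copies by j k g.
  g + (l * g + G) + l * G    ≤⟨ +-mono-≤ (+-monoʳ-≤ g (*-cancelˡ-≤ k (begin
    k * (l * g + G)                      ≡⟨ cong (λ k → k * (l * g + G)) (m+[n∸m]≡n l≤k) ⟨
    (l + j) * (l * g + G)                ≡⟨ lemma₂ l j g G ⟩
    (l + j) * (l * g) + j * G + l * G    ≤⟨ +-mono-≤ (+-monoʳ-≤ ((l + j) * (l * g)) (*-monoʳ-≤ j G≤kg)) lG≤ky ⟩
    (l + j) * (l * g) + j * (k * g) + k * y ≡⟨ cong (λ k′ → k′ * (l * g) + j * (k * g) + k * y) (m+[n∸m]≡n l≤k) ⟩
    k * (l * g) + j * (k * g) + k * y    ≡⟨ lemma₃ k l j g y ⟩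
    k * ((l + j) * g + y)                ≡⟨ cong (λ k′ → k * (k′ * g + y)) (m+[n∸m]≡n l≤k) ⟩
    k * (k * g + y)                      ∎))) lG≤ky ⟩
  g + (k * g + y) + k * y    ≡⟨ lemma₁ k g y ⟨
  suc k * (y + g)            ∎
  where
  open ≤-Reasoning
  j : ℕ
  j = k ∸ l
  lemma₁ : ∀ l g G → suc l * (G + g) ≡ g + (l * g + G) + l * G
  lemma₁ = ℕ-Solver.solve-∀
  lemma₂ : ∀ l j g G → (l + j) * (l * g + G) ≡ (l + j) * (l * g) + j * G + l * G
  lemma₂ = ℕ-Solver.solve-∀
  lemma₃ : ∀ k l j g y → k * (l * g) + j * (k * g) + k * y ≡ k * ((l + j) * g + y)
  lemma₃ = ℕ-Solver.solve-∀
... | inj₂ kg≤G = inj₂ λ y [1+l]G≤ky → begin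
  suc l * (G + g)          ≡⟨ *-distribˡ-+ (suc l) G g ⟩
  suc l * G + suc l * g    ≤⟨ +-mono-≤ [1+l]G≤ky (*-cancelˡ-≤ k (begin
    k * (suc l * g)          ≡⟨ lemma k (suc l) g ⟩
    suc l * (k * g)          ≤⟨ *-monoʳ-≤ (suc l) kg≤G ⟩
    suc l * G                ≤⟨ [1+l]G≤ky ⟩
    k * y                    ∎)) ⟩
  k * y + y                ≡⟨ +-comm (k * y) y ⟩
  suc k * y                ∎
  where
  open ≤-Reasoning
  lemma : ∀ k l g → k * (l * g) ≡ l * (k * g)
  lemma = ℕ-Solver.solve-∀

-- An averaging argument carried out one set at a time: keeping the first set leaves l choices among
-- the others, dropping it leaves l + 1, and `keep-or-drop` says which is good enough. `K` only
-- bounds the size of `E`, so the lemma still applies when some optimal sets have been chosen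
-- already.
dense-subcover : (𝒮 : Family n m) (E : Subset m) (K L : ℕ) → ∣ E ∣ ≤ K → L ≤ K →
  ∃ λ F → F ⊆ E × ∣ F ∣ ≤ L × L * ∣ covered 𝒮 E ∣ ≤ K * ∣ covered 𝒮 F ∣
dense-subcover []      []            K L       _       L≤K =
  [] , ⊆-refl , z≤n , *-monoˡ-≤ _ L≤K
dense-subcover (S ∷ 𝒮) (outside ∷ E) K L       ∣E∣≤K   L≤K
  with F , F⊆E , ∣F∣≤L , dense ← dense-subcover 𝒮 E K L ∣E∣≤K L≤K =
  outside ∷ F , s⊆s F⊆E , ∣F∣≤L , dense
dense-subcover {m = m} 𝒮 E K zero _ _ = replicate m outside , ⊥⊆ , ≤-reflexive (∣⊥∣≡0 m) , z≤n
dense-subcover (S ∷ 𝒮) (inside ∷ E) (suc k) (suc l) (s≤s ∣E∣≤k) (s≤s l≤k) with k ≤? l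
-- Here all of `E` fits into the budget. In the other case l < k, so k is nonzero and the budget l +
-- 1 is admissible for the recursive call that drops `S`.
... | yes k≤l = inside ∷ E , ⊆-refl , s≤s (≤-trans ∣E∣≤k k≤l) , *-monoˡ-≤ ∣ S ∪ covered 𝒮 E ∣ (s≤s l≤k)
... | no  k≰l
  with dense-subcover 𝒮 E k l ∣E∣≤k l≤k | dense-subcover 𝒮 E k (suc l) ∣E∣≤k (≰⇒> k≰l)
     | keep-or-drop k l ∣ S ─ covered 𝒮 E ∣ ∣ covered 𝒮 E ∣ {{>-nonZero (≤-<-trans z≤n (≰⇒> k≰l))}} l≤k
... | F , F⊆E , ∣F∣≤l , dense | _ | inj₁ keep = inside ∷ F , s⊆s F⊆E , s≤s ∣F∣≤l , (begin
  suc l * ∣ S ∪ V ∣                 ≡⟨ cong (suc l *_) (∣p∪q∣≡∣q∣+∣p─q∣ S V) ⟩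
  suc l * (∣ V ∣ + ∣ S ─ V ∣)       ≤⟨ keep ∣ W ∣ dense ⟩
  -- The marginal gain of `S` can only grow when the cover shrinks from `V` to `W`.
  suc k * (∣ W ∣ + ∣ S ─ V ∣)       ≤⟨ *-monoʳ-≤ (suc k) (+-monoʳ-≤ ∣ W ∣
    (p⊆q⇒∣p∣≤∣q∣ (─-mono S S V W (p⊆p∪q W) (covered-mono 𝒮 F⊆E)))) ⟩
  suc k * (∣ W ∣ + ∣ S ─ W ∣)       ≡⟨ cong (suc k *_) (∣p∪q∣≡∣q∣+∣p─q∣ S W) ⟨
  suc k * ∣ S ∪ W ∣                 ∎)
  where
  open ≤-Reasoning
  V W : Subset _
  V = covered 𝒮 E
  W = covered 𝒮 F
... | _ | F , F⊆E , ∣F∣≤1+l , dense | inj₂ drop = outside ∷ F , out⊆ F⊆E , ∣F∣≤1+l , (begin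
  suc l * ∣ S ∪ V ∣                 ≡⟨ cong (suc l *_) (∣p∪q∣≡∣q∣+∣p─q∣ S V) ⟩
  suc l * (∣ V ∣ + ∣ S ─ V ∣)       ≤⟨ drop ∣ covered 𝒮 F ∣ dense ⟩
  suc k * ∣ covered 𝒮 F ∣           ∎)
  where
  open ≤-Reasoning
  V : Subset _
  V = covered 𝒮 E

-- Values of the timed functions

value-replicateᵗ : ∀ n (x : A) → value (replicateᵗ n x) ≡ replicate n x
value-replicateᵗ zero    x = refl
value-replicateᵗ (suc n) x = cong (x ∷_) (value-replicateᵗ n x)

value-mapᵗ : (f : A → Timed B) (xs : Vec A n) → value (mapᵗ f xs) ≡ map (value ∘ f) xs
value-mapᵗ f []       = refl
value-mapᵗ f (x ∷ xs) = cong (_ ∷_) (value-mapᵗ f xs)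

value-∪ᵗ : (p q : Subset n) → value (p ∪ᵗ q) ≡ p ∪ q
value-∪ᵗ []      []      = refl
value-∪ᵗ (x ∷ p) (y ∷ q) = cong (_ ∷_) (value-∪ᵗ p q)

value-∖ᵗ : (p q : Subset n) → value (p ∖ᵗ q) ≡ p ─ q
value-∖ᵗ []            []            = refl
value-∖ᵗ (inside  ∷ p) (inside  ∷ q) = cong (_ ∷_) (value-∖ᵗ p q)
value-∖ᵗ (inside  ∷ p) (outside ∷ q) = cong (_ ∷_) (value-∖ᵗ p q)
value-∖ᵗ (outside ∷ p) (inside  ∷ q) = cong (_ ∷_) (value-∖ᵗ p q)
value-∖ᵗ (outside ∷ p) (outside ∷ q) = cong (_ ∷_) (value-∖ᵗ p q)

value-sizeᵗ : (p : Subset n) → value (sizeᵗ p) ≡ ∣ p ∣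
value-sizeᵗ []            = refl
value-sizeᵗ (inside  ∷ p) = cong suc (value-sizeᵗ p)
value-sizeᵗ (outside ∷ p) = value-sizeᵗ p

value-selectᵗ : (p : Subset n) (xs : Vec A n) → value (selectᵗ p xs) ≡ select p xs
value-selectᵗ []            []       = refl
value-selectᵗ (inside  ∷ p) (x ∷ xs) = cong (x ∷_) (value-selectᵗ p xs)
value-selectᵗ (outside ∷ p) (x ∷ xs) = value-selectᵗ p xs

value-coveredᵗ : (𝒮 : Family n m) (C : Subset m) → value (coveredᵗ 𝒮 C) ≡ covered 𝒮 C
value-coveredᵗ []      []            = value-replicateᵗ _ outside
value-coveredᵗ (S ∷ 𝒮) (inside  ∷ C) =
  trans (value-∪ᵗ S _) (cong (S ∪_) (value-coveredᵗ 𝒮 C))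
value-coveredᵗ (S ∷ 𝒮) (outside ∷ C) = value-coveredᵗ 𝒮 C

-- Greedy steps

IsBest : Subset m → Vec ℕ m → Maybe (Fin m × ℕ) → Set
IsBest C gs nothing        = ∀ i → i ∈ C
IsBest C gs (just (j , g)) = g ≡ lookup gs j × (∀ i → i ∈ C ⊎ lookup gs i ≤ g)

-- The tie rule decides only between equal gains, and either decision satisfies `IsBest`.
bestᵗ-isBest : (prefer : Fin m → Fin m → Bool) (C : Subset m) (gs : Vec ℕ m) →
               IsBest C gs (value (bestᵗ prefer C gs))
bestᵗ-isBest prefer []      []       ()
bestᵗ-isBest {suc m} prefer (c ∷ C) (g ∷ gs)
  with value (bestᵗ (λ i j → prefer (suc i) (suc j)) C gs)
     | bestᵗ-isBest (λ i j → prefer (suc i) (suc j)) C gs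
bestᵗ-isBest {suc m} prefer (inside  ∷ C) (g ∷ gs) | nothing | all =
  λ { zero → here ; (suc i) → there (all i) }
bestᵗ-isBest {suc m} prefer (inside  ∷ C) (g ∷ gs) | just (j , h) | h≡ , best =
  h≡ , λ { zero → inj₁ here ; (suc i) → Sum.map₁ there (best i) }
bestᵗ-isBest {suc m} prefer (outside ∷ C) (g ∷ gs) | nothing | all =
  refl , λ { zero → inj₂ ≤-refl ; (suc i) → inj₁ (there (all i)) }
bestᵗ-isBest {suc m} prefer (outside ∷ C) (g ∷ gs) | just (j , h) | h≡ , best
  with h <ᵇ g | <ᵇ-reflects-< h g | g <ᵇ h | <ᵇ-reflects-< g h | prefer zero (suc j)
... | true  | ofʸ h<g | _     | _       | _     =
  refl , λ { zero → inj₂ ≤-refl ; (suc i) → Sum.map there (λ ≤h → ≤-trans ≤h (<⇒≤ h<g)) (best i) }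
... | false | _       | true  | ofʸ g<h | _     =
  h≡ , λ { zero → inj₂ (<⇒≤ g<h) ; (suc i) → Sum.map₁ there (best i) }
... | false | _       | false | ofⁿ g≮h | true  =
  refl , λ { zero → inj₂ ≤-refl ; (suc i) → Sum.map there (λ ≤h → ≤-trans ≤h (≮⇒≥ g≮h)) (best i) }
... | false | ofⁿ h≮g | false | _       | false =
  h≡ , λ { zero → inj₂ (≮⇒≥ h≮g) ; (suc i) → Sum.map₁ there (best i) }

-- The function that `greedyStepᵗ` maps over the family, named so that its results can be abstracted
-- by `with`.
gain : Subset n → Subset n → Timed ℕ
gain V S = do
  D ← S ∖ᵗ V
  sizeᵗ D

value-gain : (𝒮 : Family n m) (C : Subset m) (i : Fin m) →
             lookup (value (mapᵗ (gain (value (coveredᵗ 𝒮 C))) 𝒮)) i ≡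
             ∣ lookup 𝒮 i ─ covered 𝒮 C ∣
value-gain 𝒮 C i = begin
  lookup (value (mapᵗ (gain V) 𝒮)) i ≡⟨ cong (λ gs → lookup gs i) (value-mapᵗ (gain V) 𝒮) ⟩
  lookup (map (value ∘ gain V) 𝒮) i  ≡⟨ lookup-map i (value ∘ gain V) 𝒮 ⟩
  value (sizeᵗ (value (lookup 𝒮 i ∖ᵗ V))) ≡⟨ value-sizeᵗ (value (lookup 𝒮 i ∖ᵗ V)) ⟩
  ∣ value (lookup 𝒮 i ∖ᵗ V) ∣         ≡⟨ cong ∣_∣ (value-∖ᵗ (lookup 𝒮 i) V) ⟩
  ∣ lookup 𝒮 i ─ V ∣                  ≡⟨ cong (λ V → ∣ lookup 𝒮 i ─ V ∣) (value-coveredᵗ 𝒮 C) ⟩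
  ∣ lookup 𝒮 i ─ covered 𝒮 C ∣        ∎
  where
  open ≡-Reasoning
  V : Subset _
  V = value (coveredᵗ 𝒮 C)

-- Sets already in `C` have gain 0, so the maximum over the remaining indices bounds the gain of
-- every set. If no index remains, g = 0 serves.
greedyStepᵗ-correct : (tie : TieRule m) (𝒮 : Family n m) (C : Subset m) →
  let C′ = value (greedyStepᵗ tie 𝒮 C) in
  ∣ C′ ∣ ≤ suc ∣ C ∣ ×
  ∃ λ g → ∣ covered 𝒮 C′ ∣ ≡ ∣ covered 𝒮 C ∣ + g × (∀ i → ∣ lookup 𝒮 i ─ covered 𝒮 C ∣ ≤ g)
greedyStepᵗ-correct {m} {n} tie 𝒮 C
  with value (bestᵗ (tie C) C (value (mapᵗ (gain (value (coveredᵗ 𝒮 C))) 𝒮)))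
     | bestᵗ-isBest (tie C) C (value (mapᵗ (gain (value (coveredᵗ 𝒮 C))) 𝒮))
... | nothing      | all      = n≤1+n ∣ C ∣ , 0 , sym (+-identityʳ _) ,
  λ i → ≤-reflexive (p⊆q⇒∣p─q∣≡0 (lookup 𝒮 i) (covered 𝒮 C) (lookup⊆covered 𝒮 (all i)))
... | just (j , g) | g≡ , best = ∣p[i]≔inside∣≤1+∣p∣ C j , g ,
  trans (cong ∣_∣ (covered-[i]≔inside 𝒮 C j))
    (trans (∣p∪q∣≡∣q∣+∣p─q∣ (lookup 𝒮 j) (covered 𝒮 C))
           (cong (λ g → ∣ covered 𝒮 C ∣ + g) (sym (trans g≡ (value-gain 𝒮 C j))))) ,
  λ i → gain≤g i (best i)
  where
  gain≤g : ∀ i → i ∈ C ⊎ lookup (value (mapᵗ (gain (value (coveredᵗ 𝒮 C))) 𝒮)) i ≤ g →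
           ∣ lookup 𝒮 i ─ covered 𝒮 C ∣ ≤ g
  gain≤g i (inj₁ i∈C) = ≤-trans
    (≤-reflexive (p⊆q⇒∣p─q∣≡0 (lookup 𝒮 i) (covered 𝒮 C) (lookup⊆covered 𝒮 i∈C))) z≤n
  gain≤g i (inj₂ ≤g)  = subst (_≤ g) (value-gain 𝒮 C i) ≤g

∣greedyᵗ∣≤ : (tie : TieRule m) (𝒮 : Family n m) (X : ℕ) → ∣ value (greedyᵗ tie 𝒮 X) ∣ ≤ X
∣greedyᵗ∣≤ {m} tie 𝒮 zero    =
  ≤-reflexive (trans (cong ∣_∣ (value-replicateᵗ m outside)) (∣⊥∣≡0 m))
∣greedyᵗ∣≤     tie 𝒮 (suc X) =
  ≤-trans (proj₁ (greedyStepᵗ-correct tie 𝒮 (value (greedyᵗ tie 𝒮 X)))) (s≤s (∣greedyᵗ∣≤ tie 𝒮 X))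

-- By the union bound the sets of `D` add at most |D| times the greedy gain to the current cover.
-- The inequality is arranged without subtraction to stay in ℕ.
greedyᵗ-progress : (tie : TieRule m) (𝒮 : Family n m) (D : Subset m) (X : ℕ) →
  let c = λ i → ∣ covered 𝒮 (value (greedyᵗ tie 𝒮 i)) ∣ in
  ∣ covered 𝒮 D ∣ + ∣ D ∣ * c X ≤ ∣ D ∣ * c (suc X) + c X
greedyᵗ-progress tie 𝒮 D X
  with g , gained , best ← proj₂ (greedyStepᵗ-correct tie 𝒮 (value (greedyᵗ tie 𝒮 X))) = begin
  ∣ covered 𝒮 D ∣ + ∣ D ∣ * ∣ V ∣        ≤⟨ +-monoˡ-≤ (∣ D ∣ * ∣ V ∣) (∣p∣≤∣q∣+∣p─q∣ (covered 𝒮 D) V) ⟩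
  ∣ V ∣ + ∣ covered 𝒮 D ─ V ∣ + ∣ D ∣ * ∣ V ∣ ≤⟨ +-monoˡ-≤ (∣ D ∣ * ∣ V ∣)
    (+-monoʳ-≤ ∣ V ∣ (∣covered─V∣≤ 𝒮 V g best D)) ⟩
  ∣ V ∣ + ∣ D ∣ * g + ∣ D ∣ * ∣ V ∣      ≡⟨ lemma ∣ V ∣ ∣ D ∣ g ⟩
  ∣ D ∣ * (∣ V ∣ + g) + ∣ V ∣            ≡⟨ cong (λ c → ∣ D ∣ * c + ∣ V ∣) gained ⟨
  ∣ D ∣ * ∣ covered 𝒮 (value (greedyᵗ tie 𝒮 (suc X))) ∣ + ∣ V ∣ ∎
  where
  open ≤-Reasoning
  V : Subset _
  V = covered 𝒮 (value (greedyᵗ tie 𝒮 X))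
  lemma : ∀ v d g → v + d * g + d * v ≡ d * (v + g) + v
  lemma = ℕ-Solver.solve-∀

-- The exact step

residual : (𝒮 : Family n m) (C : Subset m) → Family ∣ ∁ (covered 𝒮 C) ∣ ∣ ∁ C ∣
residual 𝒮 C = map (select (∁ (covered 𝒮 C))) (select (∁ C) 𝒮)

∣covered-residual∣ : (𝒮 : Family n m) (C : Subset m) (q : Subset ∣ ∁ C ∣) →
  ∣ covered (residual 𝒮 C) q ∣ ≡ ∣ covered 𝒮 (embed (∁ C) q) ─ covered 𝒮 C ∣
∣covered-residual∣ 𝒮 C q = begin
  ∣ covered (residual 𝒮 C) q ∣                ≡⟨ cong ∣_∣ (covered-map-select (∁ V) (select (∁ C) 𝒮) q) ⟩
  ∣ select (∁ V) (covered (select (∁ C) 𝒮) q) ∣ ≡⟨ ∣select-∁∣ V (covered (select (∁ C) 𝒮) q) ⟩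
  ∣ covered (select (∁ C) 𝒮) q ─ V ∣          ≡⟨ cong (λ W → ∣ W ─ V ∣) (covered-select (∁ C) 𝒮 q) ⟩
  ∣ covered 𝒮 (embed (∁ C) q) ─ V ∣           ∎
  where
  open ≡-Reasoning
  V : Subset _
  V = covered 𝒮 C

value-∁ᵗ : (p : Subset n) → value (∁ᵗ p) ≡ ∁ p
value-∁ᵗ p = value-mapᵗ _ p

completion : Algorithm → Family n m → (L : ℕ) → Subset m → Subset m
completion 𝒜 𝒮 L C = C ∪ embed (∁ C) (value (𝒜 (residual 𝒮 C) L))

value-A4 : ∀ (𝒜 : Algorithm) tie (𝒮 : Family n m) K X →
  value (A4 𝒜 tie 𝒮 K X) ≡ completion 𝒜 𝒮 (K ∸ X) (value (greedyᵗ tie 𝒮 X))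
value-A4 𝒜 tie 𝒮 K X =
  go V U R 𝒯 (value (mapᵗ (selectᵗ U) 𝒯))
     (value-coveredᵗ 𝒮 C) (value-∁ᵗ V) (value-∁ᵗ C) (value-selectᵗ R 𝒮)
     (trans (value-mapᵗ (selectᵗ U) 𝒯) (map-cong (value-selectᵗ U) 𝒯))
  where
  C R : Subset _
  C = value (greedyᵗ tie 𝒮 X)
  R = value (∁ᵗ C)
  V U : Subset _
  V = value (coveredᵗ 𝒮 C)
  U = value (∁ᵗ V)
  𝒯 : Family _ ∣ R ∣
  𝒯 = value (selectᵗ R 𝒮)
  -- The types of 𝒯 and 𝒯′ depend on U and R, so that U and R cannot be
  -- rewritten separately.
  go : ∀ V U R (𝒯 : Family _ ∣ R ∣) (𝒯′ : Family ∣ U ∣ ∣ R ∣) →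
       V ≡ covered 𝒮 C → U ≡ ∁ V → R ≡ ∁ C → 𝒯 ≡ select R 𝒮 → 𝒯′ ≡ map (select U) 𝒯 →
       value (C ∪ᵗ embed R (value (𝒜 𝒯′ (K ∸ X)))) ≡ completion 𝒜 𝒮 (K ∸ X) C
  go _ _ _ _ _ refl refl refl refl refl = value-∪ᵗ C _

∣completion∣≤ : ∀ {𝒜 : Algorithm} → IsExact 𝒜 → ∀ (𝒮 : Family n m) L C →
                ∣ completion 𝒜 𝒮 L C ∣ ≤ ∣ C ∣ + L
∣completion∣≤ {𝒜 = 𝒜} exact 𝒮 L C = begin
  ∣ C ∪ embed (∁ C) C′ ∣          ≤⟨ ∣p∪q∣≤∣p∣+∣q∣ C (embed (∁ C) C′) ⟩
  ∣ C ∣ + ∣ embed (∁ C) C′ ∣      ≡⟨ cong (λ l → ∣ C ∣ + l) (∣embed∣ (∁ C) C′) ⟩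
  ∣ C ∣ + ∣ C′ ∣                  ≤⟨ +-monoʳ-≤ ∣ C ∣ (proj₁ (exact (residual 𝒮 C) L)) ⟩
  ∣ C ∣ + L                       ∎
  where
  open ≤-Reasoning
  C′ : Subset _
  C′ = value (𝒜 (residual 𝒮 C) L)

completion-covers : ∀ {𝒜 : Algorithm} → IsExact 𝒜 → ∀ (𝒮 : Family n m) L C D → L ≤ ∣ D ∣ →
  let K = ∣ D ∣ in
  L * ∣ covered 𝒮 D ∣ + (K ∸ L) * ∣ covered 𝒮 C ∣ ≤ K * ∣ covered 𝒮 (completion 𝒜 𝒮 L C) ∣
completion-covers {𝒜 = 𝒜} exact 𝒮 L C D L≤K
  -- Greedy may have taken some members of `D`, so those left may number fewer than |D|; |D| serves
  -- as their upper bound.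
  with F , _ , ∣F∣≤L , dense ← dense-subcover (residual 𝒮 C) (select (∁ C) D) ∣ D ∣ L
    (∣select∣≤ (∁ C) D) L≤K = begin
  L * ∣ W ∣ + (K ∸ L) * ∣ V ∣
    ≤⟨ +-monoˡ-≤ ((K ∸ L) * ∣ V ∣) (*-monoʳ-≤ L (∣p∣≤∣q∣+∣p─q∣ W V)) ⟩
  L * (∣ V ∣ + ∣ W ─ V ∣) + (K ∸ L) * ∣ V ∣
    -- What `D` covers outside `V` is covered by members of `D` outside `C`.
    ≤⟨ +-monoˡ-≤ ((K ∸ L) * ∣ V ∣) (*-monoʳ-≤ L (+-monoʳ-≤ ∣ V ∣
        (p⊆q⇒∣p∣≤∣q∣ (─-mono W W′ V V W⊆ ⊆-refl)))) ⟩
  L * (∣ V ∣ + ∣ W′ ─ V ∣) + (K ∸ L) * ∣ V ∣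
    ≡⟨ cong (λ w → L * (∣ V ∣ + w) + (K ∸ L) * ∣ V ∣) (∣covered-residual∣ 𝒮 C E) ⟨
  L * (∣ V ∣ + ∣ covered (residual 𝒮 C) E ∣) + (K ∸ L) * ∣ V ∣
    ≡⟨ lemma L (K ∸ L) ∣ V ∣ ∣ covered (residual 𝒮 C) E ∣ ⟩
  (L + (K ∸ L)) * ∣ V ∣ + L * ∣ covered (residual 𝒮 C) E ∣
    ≡⟨ cong (λ k → k * ∣ V ∣ + L * ∣ covered (residual 𝒮 C) E ∣) (m+[n∸m]≡n L≤K) ⟩
  K * ∣ V ∣ + L * ∣ covered (residual 𝒮 C) E ∣
    ≤⟨ +-monoʳ-≤ (K * ∣ V ∣) (≤-trans dense (*-monoʳ-≤ K (proj₂ (exact (residual 𝒮 C) L) F ∣F∣≤L))) ⟩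
  K * ∣ V ∣ + K * ∣ covered (residual 𝒮 C) C′ ∣
    ≡⟨ cong (λ w → K * ∣ V ∣ + K * w) (∣covered-residual∣ 𝒮 C C′) ⟩
  K * ∣ V ∣ + K * ∣ covered 𝒮 (embed (∁ C) C′) ─ V ∣
    ≡⟨ *-distribˡ-+ K ∣ V ∣ _ ⟨
  K * (∣ V ∣ + ∣ covered 𝒮 (embed (∁ C) C′) ─ V ∣)
    ≡⟨ cong (K *_) (∣p∪q∣≡∣q∣+∣p─q∣ (covered 𝒮 (embed (∁ C) C′)) V) ⟨
  K * ∣ covered 𝒮 (embed (∁ C) C′) ∪ V ∣
    ≡⟨ cong (λ W → K * ∣ W ∣) (trans (∪-comm _ V) (sym (covered-∪ 𝒮 C (embed (∁ C) C′)))) ⟩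
  K * ∣ covered 𝒮 (completion 𝒜 𝒮 L C) ∣ ∎
  where
  open ≤-Reasoning
  K : ℕ
  K = ∣ D ∣
  E C′ : Subset _
  E = select (∁ C) D
  C′ = value (𝒜 (residual 𝒮 C) L)
  V W W′ : Subset _
  V = covered 𝒮 C
  W = covered 𝒮 D
  W′ = covered 𝒮 (embed (∁ C) E)
  W⊆ : W ⊆ W′ ∪ V
  W⊆ = subst (W ⊆_) (covered-∪ 𝒮 (embed (∁ C) E) C) (covered-mono 𝒮 (p⊆embed-select-∁∪q D C))
  lemma : ∀ l j v e → l * (v + e) + j * v ≡ (l + j) * v + l * e
  lemma = ℕ-Solver.solve-∀

-- Running times

time-replicateᵗ : ∀ n (x : A) → time (replicateᵗ n x) ≡ suc n
time-replicateᵗ zero    x = refl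
-- A closing `return` contributes `+ 0`, which `+-identityʳ` removes here and in the similar proofs
-- below.
time-replicateᵗ (suc n) x = cong suc (trans (+-identityʳ _) (time-replicateᵗ n x))

time-zipWithᵗ : ∀ {C : Set} {c} (f : A → B → Timed C) → (∀ x y → time (f x y) ≡ c) →
                (xs : Vec A n) (ys : Vec B n) → time (zipWithᵗ f xs ys) ≡ suc (n * suc c)
time-zipWithᵗ f f≡c []       []       = refl
time-zipWithᵗ {c = c} f f≡c (x ∷ xs) (y ∷ ys) = cong suc
  (trans (cong₂ _+_ (f≡c x y) (trans (+-identityʳ _) (time-zipWithᵗ f f≡c xs ys))) (+-suc c _))

time-mapᵗ : ∀ {c} (f : A → Timed B) → (∀ x → time (f x) ≤ c) →
            (xs : Vec A n) → time (mapᵗ f xs) ≤ suc (n * suc c)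
time-mapᵗ f f≤c []       = ≤-refl
time-mapᵗ {c = c} f f≤c (x ∷ xs) = s≤s (≤-trans
  (+-mono-≤ (f≤c x) (≤-trans (≤-reflexive (+-identityʳ _)) (time-mapᵗ f f≤c xs)))
  (≤-reflexive (+-suc c _)))

time-selectᵗ : (p : Subset n) (xs : Vec A n) → time (selectᵗ p xs) ≡ suc n
time-selectᵗ []            []       = refl
time-selectᵗ (inside  ∷ p) (x ∷ xs) = cong suc (trans (+-identityʳ _) (time-selectᵗ p xs))
time-selectᵗ (outside ∷ p) (x ∷ xs) = cong suc (time-selectᵗ p xs)

time-embedᵗ : (p : Subset n) (q : Subset ∣ p ∣) → time (embedᵗ p q) ≡ suc n
time-embedᵗ []            []      = refl
time-embedᵗ (inside  ∷ p) (x ∷ q) = cong suc (trans (+-identityʳ _) (time-embedᵗ p q))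
time-embedᵗ (outside ∷ p) q       = cong suc (trans (+-identityʳ _) (time-embedᵗ p q))

time-∁ᵗ : (p : Subset n) → time (∁ᵗ p) ≤ suc (n * 2)
time-∁ᵗ p = time-mapᵗ _ (λ _ → ≤-refl) p

time-∪ᵗ : (p q : Subset n) → time (p ∪ᵗ q) ≡ suc (n * 2)
time-∪ᵗ p q = time-zipWithᵗ _ (λ _ _ → refl) p q

time-sizeᵗ : (p : Subset n) → time (sizeᵗ p) ≡ suc n
time-sizeᵗ []      = refl
time-sizeᵗ (x ∷ p) = cong suc (trans (+-identityʳ _) (time-sizeᵗ p))

time-gain : (V S : Subset n) → time (gain V S) ≡ suc (n * 2) + suc n
time-gain V S = cong₂ _+_ (time-zipWithᵗ _ (λ _ _ → refl) S V) (time-sizeᵗ (value (S ∖ᵗ V)))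

time-bestᵗ : (prefer : Fin m → Fin m → Bool) (C : Subset m) (gs : Vec ℕ m) →
             time (bestᵗ prefer C gs) ≡ suc m
time-bestᵗ prefer []      []       = refl
time-bestᵗ prefer (c ∷ C) (g ∷ gs) = cong suc (trans (+-identityʳ _) (time-bestᵗ _ C gs))

-- Each of the m + 1 clauses is charged for a tick and a union, 2 + 2n in all; this also pays for
-- `∅ᵗ` at the end.
time-coveredᵗ : (𝒮 : Family n m) (C : Subset m) → time (coveredᵗ 𝒮 C) ≤ suc m * (2 + n * 2)
time-coveredᵗ {n} [] [] = begin
  suc (time (replicateᵗ n outside))  ≡⟨ cong suc (time-replicateᵗ n outside) ⟩
  2 + n                              ≤⟨ +-monoʳ-≤ 2 (m≤m*n n 2) ⟩
  2 + n * 2                          ≡⟨ *-identityˡ (2 + n * 2) ⟨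
  1 * (2 + n * 2)                    ∎
  where open ≤-Reasoning
time-coveredᵗ {n} {suc m} (S ∷ 𝒮) (inside ∷ C) = begin
  suc (time (coveredᵗ 𝒮 C) + time (S ∪ᵗ value (coveredᵗ 𝒮 C)))
    ≤⟨ s≤s (+-mono-≤ (time-coveredᵗ 𝒮 C) (≤-reflexive (time-∪ᵗ S (value (coveredᵗ 𝒮 C))))) ⟩
  suc (suc m * (2 + n * 2) + suc (n * 2))
    ≡⟨ lemma (suc m * (2 + n * 2)) (n * 2) ⟩
  suc (suc m) * (2 + n * 2) ∎
  where
  open ≤-Reasoning
  lemma : ∀ a b → suc (a + suc b) ≡ 2 + b + a
  lemma = ℕ-Solver.solve-∀
time-coveredᵗ {n} {suc m} (S ∷ 𝒮) (outside ∷ C) =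
  ≤-trans (s≤s (time-coveredᵗ 𝒮 C)) (s≤s (m≤n+m (suc m * (2 + n * 2)) (suc (n * 2))))

-- The polynomial that bounds the time outside the exact algorithm.

module _ where
  open +-*-Solver

  private
    N K M : Polynomial 3
    N = var zero
    K = var (suc zero)
    M = var (suc (suc zero))

  -- The polynomials follow the shape of the time bounds, so that their values agree with these by
  -- computation.
  coverTime gainTime stepTime greedyTime A4Time : Polynomial 3
  coverTime  = (con 1 :+ M) :* (con 2 :+ N :* con 2)
  gainTime   = con 1 :+ N :* con 2 :+ (con 1 :+ N)
  stepTime   = con 1 :+ (coverTime :+ (con 1 :+ M :* (con 1 :+ gainTime) :+ (con 1 :+ M)))
  greedyTime = con 2 :+ M :+ K :* (con 1 :+ stepTime)
  A4Time     = con 1 :+ (greedyTime :+ (coverTime :+ (con 1 :+ N :* con 2 :+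
    (con 1 :+ M :* con 2 :+ (con 1 :+ M :+ (con 1 :+ M :* (con 2 :+ N) :+
    (con 1 :+ M :+ (con 1 :+ M :* con 2))))))))

module _ (𝒜 : Algorithm) (f : ℕ → ℕ → ℕ → ℕ) (tie : TieRule m) (𝒮 : Family n m) (K : ℕ) where

  private
    ⟪_⟫ : Polynomial 3 → ℕ
    ⟪ p ⟫ = ⟦ p ⟧ (n ∷ K ∷ m ∷ [])

  time-greedyStepᵗ : ∀ C → time (greedyStepᵗ tie 𝒮 C) ≤ ⟪ stepTime ⟫
  time-greedyStepᵗ C = s≤s (+-mono-≤ (time-coveredᵗ 𝒮 C)
    (+-mono-≤ (time-mapᵗ _ (λ S → ≤-reflexive (time-gain (value (coveredᵗ 𝒮 C)) S)) 𝒮)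
              (≤-reflexive (trans (+-identityʳ _) (time-bestᵗ (tie C) C _)))))

  time-greedyᵗ : ∀ X → time (greedyᵗ tie 𝒮 X) ≤ 2 + m + X * (1 + ⟪ stepTime ⟫)
  time-greedyᵗ zero    = ≤-reflexive (trans (cong suc (time-replicateᵗ m outside)) (sym (+-identityʳ _)))
  time-greedyᵗ (suc X) = begin
    suc (time (greedyᵗ tie 𝒮 X) + time (greedyStepᵗ tie 𝒮 (value (greedyᵗ tie 𝒮 X))))
      ≤⟨ s≤s (+-mono-≤ (time-greedyᵗ X) (time-greedyStepᵗ (value (greedyᵗ tie 𝒮 X)))) ⟩
    suc (2 + m + X * (1 + s) + s)
      ≡⟨ lemma m X s ⟩
    2 + m + suc X * (1 + s) ∎
    where
    open ≤-Reasoning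
    s : ℕ
    s = ⟪ stepTime ⟫
    lemma : ∀ m X s → suc (2 + m + X * (1 + s) + s) ≡ 2 + m + suc X * (1 + s)
    lemma = ℕ-Solver.solve-∀

  time-A4 : HasRunningTime 𝒜 f → ∀ X → X ≤ K →
            time (A4 𝒜 tie 𝒮 K X) ≤ f (K ∸ X) n m + ⟪ A4Time ⟫
  time-A4 𝒜-time X X≤K = ≤-trans
    -- X is bounded by K here, as the polynomial has K but not X among its variables.
    (s≤s (+-mono-≤ (≤-trans (time-greedyᵗ X) (+-monoʳ-≤ (2 + m) (*-monoˡ-≤ (1 + ⟪ stepTime ⟫) X≤K)))
         (+-mono-≤ (time-coveredᵗ 𝒮 C)
         (+-mono-≤ (time-∁ᵗ V)
         (+-mono-≤ (time-∁ᵗ C)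
         (+-mono-≤ (≤-reflexive (time-selectᵗ R 𝒮))
         (+-mono-≤ (≤-trans (time-mapᵗ (selectᵗ U) (λ S → ≤-reflexive (time-selectᵗ U S)) 𝒯)
                            (s≤s (*-monoˡ-≤ (2 + n) (∣p∣≤n R))))
         -- The residual instance has |U| ≤ n elements and |R| ≤ m sets, so `HasRunningTime` applies
         -- with the original n and m.
         (+-mono-≤ (𝒜-time (value (mapᵗ (selectᵗ U) 𝒯)) (K ∸ X) (∣p∣≤n U) (∣p∣≤n R))
         (+-mono-≤ (≤-reflexive (time-embedᵗ R _))
                   (≤-reflexive (time-∪ᵗ C _)))))))))))
    (≤-reflexive (lemma ⟪ greedyTime ⟫ ⟪ coverTime ⟫ (suc (n * 2)) (suc (m * 2)) (suc m)
      (suc (m * (2 + n))) (f (K ∸ X) n m) (suc m) (suc (m * 2))))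
    where
    C R : Subset m
    C = value (greedyᵗ tie 𝒮 X)
    R = value (∁ᵗ C)
    V U : Subset n
    V = value (coveredᵗ 𝒮 C)
    U = value (∁ᵗ V)
    𝒯 : Family n ∣ R ∣
    𝒯 = value (selectᵗ R 𝒮)
    lemma : ∀ g c u r s t a e z →
      1 + (g + (c + (u + (r + (s + (t + (a + (e + z)))))))) ≡
      a + (1 + (g + (c + (u + (r + (s + (t + (e + z))))))))
    lemma = ℕ-Solver.solve-∀

-- The approximation guarantee, the size of the output, and the theorem.

A4-covers : ∀ {𝒜 : Algorithm} → IsExact 𝒜 → (𝒮 : Family n m) (K X : ℕ) → X ≤ K →
            (tie : TieRule m) .{{_ : NonZero K}} (opt : ℕ) → IsOPT 𝒮 K opt →
            Lim guarantee K X opt ≤ (+ ∣ covered 𝒮 (value (A4 𝒜 tie 𝒮 K X)) ∣ / 1)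
A4-covers {𝒜 = 𝒜} exact 𝒮 (suc k) X X≤K tie opt ((D , ∣D∣≡K , covers) , _)
  rewrite value-A4 𝒜 tie 𝒮 (suc k) X | sym covers =
  ExponentialBound.deficit-bound k X (∣ covered 𝒮 D ∣) c (∣ covered 𝒮 (completion 𝒜 𝒮 L C) ∣) X≤K
    (λ i _ → subst (λ K → ∣ covered 𝒮 D ∣ + K * c i ≤ K * c (suc i) + c i) ∣D∣≡K
               (greedyᵗ-progress tie 𝒮 D i))
    -- `completion-covers` yields the coefficient K ∸ L, which is K ∸ (K ∸ X) = X.
    (subst (λ l → L * ∣ covered 𝒮 D ∣ + l * c X ≤ suc k * ∣ covered 𝒮 (completion 𝒜 𝒮 L C) ∣)
      (m∸[m∸n]≡n X≤K)
      (subst (λ K → L * ∣ covered 𝒮 D ∣ + (K ∸ L) * c X ≤ K * ∣ covered 𝒮 (completion 𝒜 𝒮 L C) ∣) ∣D∣≡K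
        (completion-covers {𝒜 = 𝒜} exact 𝒮 L C D
          (≤-trans (m∸n≤m (suc k) X) (≤-reflexive (sym ∣D∣≡K))))))
  where
  L : ℕ
  L = suc k ∸ X
  C : Subset _
  C = value (greedyᵗ tie 𝒮 X)
  c : ℕ → ℕ
  c i = ∣ covered 𝒮 (value (greedyᵗ tie 𝒮 i)) ∣

∣A4∣≤ : ∀ {𝒜 : Algorithm} → IsExact 𝒜 → (𝒮 : Family n m) (K X : ℕ) → X ≤ K →
        (tie : TieRule m) → ∣ value (A4 𝒜 tie 𝒮 K X) ∣ ≤ K
∣A4∣≤ {𝒜 = 𝒜} exact 𝒮 K X X≤K tie rewrite value-A4 𝒜 tie 𝒮 K X = begin
  ∣ completion 𝒜 𝒮 (K ∸ X) C ∣  ≤⟨ ∣completion∣≤ {𝒜 = 𝒜} exact 𝒮 (K ∸ X) C ⟩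
  ∣ C ∣ + (K ∸ X)               ≤⟨ +-monoˡ-≤ (K ∸ X) (∣greedyᵗ∣≤ tie 𝒮 X) ⟩
  X + (K ∸ X)                   ≡⟨ m+[n∸m]≡n X≤K ⟩
  K                             ∎
  where
  open ≤-Reasoning
  C : Subset _
  C = value (greedyᵗ tie 𝒮 X)

mainTheorem12 :
  (𝒜 : Algorithm) (f : ℕ → ℕ → ℕ → ℕ) →
  IsExact 𝒜 → HasRunningTime 𝒜 f →
  Σ (Polynomial 3) λ p →
    ∀ {n m} (𝒮 : Family n m) (K X : ℕ) → K ≤ m → X ≤ K →
    (tie : TieRule m) →
    let run = A4 𝒜 tie 𝒮 K X
        C   = value run
    in
    ∣ C ∣ ≤ K ×
    (.{{_ : NonZero K}} (opt : ℕ) → IsOPT 𝒮 K opt →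
      Lim guarantee K X opt ≤ (+ ∣ covered 𝒮 C ∣ / 1)) ×
    time run ≤ f (K ∸ X) n m + ⟦ p ⟧ (n ∷ K ∷ m ∷ [])
mainTheorem12 𝒜 f exact 𝒜-time = A4Time , λ 𝒮 K X _ X≤K tie →
  ∣A4∣≤ {𝒜 = 𝒜} exact 𝒮 K X X≤K tie ,
  (λ opt → A4-covers {𝒜 = 𝒜} exact 𝒮 K X X≤K tie opt) ,
  time-A4 𝒜 f tie 𝒮 K 𝒜-time X X≤K
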